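{- For all integers $n \geq 0$, $$dp(27n+16) \equiv 0 \pmod{3}.$$
   Context: A partition of a positive integer $n$ is a nonincreasing sequence of positive integers (called parts) whose sum is $n$. For $n\ge 0$, $dp(n)$ denotes the number of partitions of $n$ in which every part is either divisible by $4$ or congruent to $\pm 1 \pmod 6$ (with $dp(0)=1$). Equivalently, its generating function is $$\sum_{n=0}^{\infty} dp(n)q^n = \frac{1}{(q;q^6)_\infty (q^5;q^6)_\infty (q^4;q^4)_\infty},$$ where $(a;q)_\infty := (1-a)(1-aq)(1-aq^2)\cdots$. -}

module Defs where

open import Data.List.Base using (List; []; _∷_; [_]; map; concatMap; filter; length; upTo)
open import Data.List.Membership.Propositional using (_∈_; lose; find)
open import Data.List.Membership.Propositional.Properties
  using (∈-map⁺; ∈-map⁻; ∈-concatMap⁺; ∈-concatMap⁻; ∈-upTo⁺; ∈-upTo⁻; ∈-filter⁺; ∈-filter⁻)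
open import Data.List.Properties using (∷-injectiveʳ)
open import Data.List.Relation.Binary.Disjoint.Propositional using (Disjoint)
open import Data.List.Relation.Unary.All as All using (All; []; _∷_; all?)
import Data.List.Relation.Unary.All.Properties as All
open import Data.List.Relation.Unary.AllPairs as AllPairs using ([]; _∷_)
import Data.List.Relation.Unary.AllPairs.Properties as AllPairs
open import Data.List.Relation.Unary.Any using (here)
open import Data.List.Relation.Unary.Linked using (Linked; []; [-]; _∷_; tail)
open import Data.List.Relation.Unary.Unique.Propositional using (Unique)
import Data.List.Relation.Unary.Unique.Propositional.Properties as Unique
open import Data.Nat.Base
open import Data.Nat.Divisibility using (_∣_; _∣?_)
open import Data.Nat.ListAction using (sum)
open import Data.Nat.Properties
open import Data.Product.Base using (_×_; _,_)
open import Data.Sum.Base using (_⊎_)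
open import Function.Bundles using (_⇔_; mk⇔; module Equivalence)
open import Relation.Binary.PropositionalEquality using (_≡_; _≢_; refl; sym; trans; cong)
open import Relation.Nullary.Decidable using (_⊎-dec_)
open import Relation.Unary using (Decidable)

record IsPartition (n : ℕ) (ps : List ℕ) : Set where
  constructor isPartition
  field
    nonincreasing : Linked _≥_ ps
    positive      : All (0 <_) ps
    sum≡          : sum ps ≡ n

-- Divisible by 4, or congruent to ±1 modulo 6.
Allowed : ℕ → Set
Allowed k = 4 ∣ k ⊎ (k % 6 ≡ 1 ⊎ k % 6 ≡ 5)

allowed? : Decidable Allowed
allowed? k = (4 ∣? k) ⊎-dec ((k % 6 ≟ 1) ⊎-dec (k % 6 ≟ 5))

-- The partitions of n into at most ℓ parts, each at most m; the first part
-- is suc i.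
partitions≤ : (ℓ m n : ℕ) → List (List ℕ)
partitions≤ _       _ zero    = [ [] ]
partitions≤ zero    _ (suc n) = []
partitions≤ (suc ℓ) m (suc n) =
  concatMap (λ i → map (suc i ∷_) (partitions≤ ℓ (suc i) (n ∸ i))) (upTo (m ⊓ suc n))

-- A partition of n has at most n parts, each at most n.
partitions : ℕ → List (List ℕ)
partitions n = partitions≤ n n n

dpPartitions : ℕ → List (List ℕ)
dpPartitions n = filter (all? allowed?) (partitions n)

dp : ℕ → ℕ
dp n = length (dpPartitions n)

-- The rest shows that dpPartitions n lists every partition of n into allowed
-- parts exactly once, so that dp n is indeed their number.

private
  -- Linked _≥_ (m ∷ ps) says that ps is nonincreasing with parts at most m.
  sound : ∀ ℓ m n {ps} → ps ∈ partitions≤ ℓ m n →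
          Linked _≥_ (m ∷ ps) × All (0 <_) ps × sum ps ≡ n
  sound zero    m zero    (here refl) = [-] , [] , refl
  sound (suc ℓ) m zero    (here refl) = [-] , [] , refl
  sound (suc ℓ) m (suc n) ps∈
    with i , i∈ , ps∈′ ← find (∈-concatMap⁻ _ {xs = upTo (m ⊓ suc n)} ps∈)
    with qs , qs∈ , refl ← ∈-map⁻ (suc i ∷_) ps∈′
    with i< ← ∈-upTo⁻ i∈
    with dec , pos , eq ← sound ℓ (suc i) (n ∸ i) qs∈
    = m≤n⊓o⇒m≤n m (suc n) i< ∷ dec
    , z<s ∷ pos
    , cong suc (trans (cong (i +_) eq) (m+[n∸m]≡n (s≤s⁻¹ (m≤n⊓o⇒m≤o m (suc n) i<))))

  complete : ∀ ℓ m n {ps} → Linked _≥_ (m ∷ ps) → All (0 <_) ps → sum ps ≡ n →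
             length ps ≤ ℓ → ps ∈ partitions≤ ℓ m n
  complete zero    m zero    {[]}         _ _ _ _ = here refl
  complete (suc ℓ) m zero    {[]}         _ _ _ _ = here refl
  complete (suc ℓ) m (suc n) {suc i ∷ qs} (i<m ∷ dec) (_ ∷ pos) refl (s≤s len) =
    ∈-concatMap⁺ _ (lose (∈-upTo⁺ (⊓-glb i<m (m≤m+n (suc i) (sum qs))))
      (∈-map⁺ (suc i ∷_)
        (complete ℓ (suc i) (n ∸ i) dec pos (sym (m+n∸m≡n i (sum qs))) len)))
  complete (suc ℓ) m zero    {zero ∷ _}   _ (() ∷ _) _ _
  complete (suc ℓ) m (suc n) {zero ∷ _}   _ (() ∷ _) _ _

  unique : ∀ ℓ m n → Unique (partitions≤ ℓ m n)
  unique zero    m zero    = [] ∷ []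
  unique (suc ℓ) m zero    = [] ∷ []
  unique zero    m (suc n) = []
  unique (suc ℓ) m (suc n) = Unique.concat⁺
    (All.map⁺ (All.universal
      (λ i → Unique.map⁺ ∷-injectiveʳ (unique ℓ (suc i) (n ∸ i))) _))
    (AllPairs.map⁺ (AllPairs.map disjoint (Unique.upTo⁺ (m ⊓ suc n))))
    where
    disjoint : ∀ {i j} {xss yss : List (List ℕ)} → i ≢ j →
               Disjoint (map (suc i ∷_) xss) (map (suc j ∷_) yss)
    disjoint i≢j (v∈₁ , v∈₂)
      with _ , _ , refl ← ∈-map⁻ _ v∈₁
      with _ , _ , refl ← ∈-map⁻ _ v∈₂ = i≢j refl

  length≤sum : ∀ {ps} → All (0 <_) ps → length ps ≤ sum ps
  length≤sum []          = z≤n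
  length≤sum (p>0 ∷ pos) = +-mono-≤ p>0 (length≤sum pos)

  sum∷ : ∀ {ps} → Linked _≥_ ps → Linked _≥_ (sum ps ∷ ps)
  sum∷ {[]}     _   = [-]
  sum∷ {p ∷ ps} dec = m≤m+n p (sum ps) ∷ dec

∈-partitions : ∀ {n ps} → ps ∈ partitions n ⇔ IsPartition n ps
∈-partitions {n} {ps} = mk⇔ to from
  where
  to : ps ∈ partitions n → IsPartition n ps
  to ps∈ with dec , pos , eq ← sound n n n ps∈ = isPartition (tail dec) pos eq

  from : IsPartition n ps → ps ∈ partitions n
  from (isPartition dec pos refl) = complete n n n (sum∷ dec) pos refl (length≤sum pos)

∈-dpPartitions : ∀ {n ps} → ps ∈ dpPartitions n ⇔ (IsPartition n ps × All Allowed ps)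
∈-dpPartitions {n} = mk⇔
  (λ ps∈ → let ps∈′ , ok = ∈-filter⁻ (all? allowed?) {xs = partitions n} ps∈
           in Equivalence.to ∈-partitions ps∈′ , ok)
  (λ (isP , ok) → ∈-filter⁺ (all? allowed?) (Equivalence.from ∈-partitions isP) ok)

dpPartitions-unique : ∀ n → Unique (dpPartitions n)
dpPartitions-unique n = Unique.filter⁺ (all? allowed?) (unique n n n)

module Submission where

-- The proof works in 𝔽₃[[q]], where S(q³) = S(q)³ for every series S. Write
-- fₖ = (qᵏ; qᵏ)∞, φ = Σ (-1)ⁿ q^(n²), Ω = Σ (-1)ⁿ q^(3n² - 2n) (sums over ℤ),
-- a = (q; q⁶)∞ (q⁵; q⁶)∞, and G for the generating function of dp, so that
-- G a f₄ = 1. Regrouping factors gives a f₂ f₃ = f₁ f₆, and the Jacobi triple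
-- product gives φ f₂ = f₁² and Ω = a f₆. With f₃ = f₁³ and f₆ = f₂³ these yield
-- a φ = f₂, Ω φ = f₂⁴ and f₂³ G = φ(q) φ(q²).
-- Splitting the exponent n² by n modulo 3 shows φ = φ(q⁹) + q Ω(q³). Hence the
-- section A₁ of G at exponents 3n + 1 satisfies f₂ A₁ = Ω φ(q²)³, that is
-- φ A₁ = f₂³ φ(q²)³. Multiplying by φ², the section A₂ of A₁ at exponents 3n + 2
-- satisfies φ A₂ = f₂ φ(q²) Ω², so φ³ A₂ = f₂⁹ φ(q²). Here φ³ and f₂⁹ are
-- series in q³, and no exponent 2n² of φ(q²) is congruent to 1 modulo 3.

-- Only a series in q³, which modulo 3 is the same as a cube, can be pulled out of a section. So
-- each of the three sections is preceded by a multiplication that completes a cube: f₂³ for G, and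
-- φ² for φ A₁ and again for φ A₂. The last φ² does a second job: it absorbs Ω² through Ω φ = f₂⁴.
-- Quotients are never formed. They are stated as product equations, from which factors with
-- constant term 1 are cancelled. Infinite products and theta series are coefficientwise limits; the
-- basic identities between them are checked on partial products and sums and carried over by
-- uniqueness of limits.

open import Defs using (dp)
open import Data.Nat.Base using (ℕ; _+_; _*_; _%_)
open import Relation.Binary.PropositionalEquality using (_≡_)

open import Algebra.Bundles using (CommutativeRing)
import Algebra.Solver.Ring as RingSolver
open import Algebra.Solver.Ring.AlmostCommutativeRing
  using (fromCommutativeRing; _-Raw-AlmostCommutative⟶_; Induced-equivalence)
import Algebra.Solver.Ring.Simple as SimpleRingSolver
open import Algebra.Structures using (IsCommutativeRing)
open import Data.Bool.Base using (Bool; true; false; if_then_else_)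
open import Data.Fin.Base using (Fin; zero; suc; toℕ)
open import Data.Fin.Properties as Fin using (_≟_)
open import Data.List.Base
  using (List; []; _∷_; _++_; _∷ʳ_; [_]; map; concatMap; concat; filter; length; upTo)
open import Data.List.Properties
  using (concatMap-cong; concat-++; map-++; filter-++; length-++; upTo-∷ʳ; ++-identityʳ)
open import Data.List.Relation.Unary.All using (all?)
open import Data.Maybe.Base using (just; nothing)
open import Data.Nat.Base
  using (zero; suc; pred; _∸_; _⊔_; _⊓_; _≤_; _<_; z≤n; s≤s; s≤s⁻¹; NonZero; >-nonZero⁻¹)
open import Data.Nat.Properties
  using ( ≤-refl; ≤-reflexive; ≤-trans; <⇒≤; <-≤-trans; ≤-<-connex; n<1+n; m≤n⇒m≤1+n; m<n⇒m<1+n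
        ; m≤m⊔n; m≤n⊔m; m≤n⇒m⊓n≡m; m≥n⇒m⊓n≡n; m≤m+n; m≤n+m; m≤m*n; m∸n≤m; m∸n+n≡m
        ; +-suc; +-comm; +-identityʳ; +-mono-≤; +-monoʳ-≤; +-cancelʳ-≤
        ; *-assoc; *-identityʳ; *-distribʳ-+; module ≤-Reasoning )
open import Data.Nat.Solver using (module +-*-Solver)
open import Data.Product.Base using (_,_; ∃)
open import Data.Sum.Base using (inj₁; inj₂)
open import Defs using (allowed?; partitions≤)
open import Level using (0ℓ)
open import Relation.Binary.Bundles using (Setoid)
open import Relation.Binary.PropositionalEquality
  using (refl; sym; trans; cong; cong₂; isEquivalence; module ≡-Reasoning)
open import Relation.Binary.Definitions using (WeaklyDecidable)
import Relation.Binary.Reasoning.Setoid as SetoidReasoning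
open import Relation.Nullary.Decidable using (toWitness; does; yes; no)

open +-*-Solver using ()
  renaming (solve to ℕ-solve; _:+_ to _⊞_; _:*_ to _⊠_; _:=_ to _≐_; con to κ)

-- The ring 𝔽₃[[q]]

𝔽₃ : Set
𝔽₃ = Fin 3

pattern 0₃ = zero
pattern 1₃ = suc zero
pattern 2₃ = suc (suc zero)

infixl 6 _+₃_
infixl 7 _*₃_
infix  8 -₃_

next : 𝔽₃ → 𝔽₃
next 0₃ = 1₃
next 1₃ = 2₃
next 2₃ = 0₃

_+₃_ _*₃_ : 𝔽₃ → 𝔽₃ → 𝔽₃
0₃ +₃ y = y
1₃ +₃ y = next y
2₃ +₃ y = next (next y)

0₃ *₃ y = 0₃
1₃ *₃ y = y
2₃ *₃ y = y +₃ y

-₃_ : 𝔽₃ → 𝔽₃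
-₃ x = x +₃ x

𝔽₃-isCommutativeRing : IsCommutativeRing _≡_ _+₃_ _*₃_ -₃_ 0₃ 1₃
𝔽₃-isCommutativeRing = record
  { isRing = record
    { +-isAbelianGroup = record
      { isGroup = record
        { isMonoid = record
          { isSemigroup = record
            { isMagma = record { isEquivalence = isEquivalence ; ∙-cong = cong₂ _+₃_ }
            ; assoc = toWitness {a? = Fin.all? λ x → Fin.all? λ y → Fin.all? λ z → _ ≟ _} _
            }
          ; identity = (λ _ → refl) , toWitness {a? = Fin.all? λ x → _ ≟ _} _
          }
        ; inverse = toWitness {a? = Fin.all? λ x → _ ≟ _} _ , toWitness {a? = Fin.all? λ x → _ ≟ _} _
        ; ⁻¹-cong = cong -₃_
        }
      ; comm = toWitness {a? = Fin.all? λ x → Fin.all? λ y → _ ≟ _} _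
      }
    ; *-cong = cong₂ _*₃_
    ; *-assoc = toWitness {a? = Fin.all? λ x → Fin.all? λ y → Fin.all? λ z → _ ≟ _} _
    ; *-identity = (λ _ → refl) , toWitness {a? = Fin.all? λ x → _ ≟ _} _
    ; distrib = toWitness {a? = Fin.all? λ x → Fin.all? λ y → Fin.all? λ z → _ ≟ _} _
              , toWitness {a? = Fin.all? λ x → Fin.all? λ y → Fin.all? λ z → _ ≟ _} _
    }
  ; *-comm = toWitness {a? = Fin.all? λ x → Fin.all? λ y → _ ≟ _} _
  }

𝔽₃-commutativeRing : CommutativeRing 0ℓ 0ℓ
𝔽₃-commutativeRing = record { isCommutativeRing = 𝔽₃-isCommutativeRing }

module 𝔽₃-Solver = SimpleRingSolver (fromCommutativeRing 𝔽₃-commutativeRing) _≟_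

Series : Set
Series = ℕ → 𝔽₃

infix 4 _≈_
-- A record and not a bare function type, so that `S` and `T` can be inferred from a goal.
record _≈_ (S T : Series) : Set where
  constructor coeffwise
  field coeff : ∀ n → S n ≡ T n
open _≈_ public

infixl 6 _⊕_
infixl 7 _⊗_
infix  8 ⊖_

tail : Series → Series
tail S n = S (suc n)

const : 𝔽₃ → Series
const c zero    = c
const c (suc _) = 0₃

𝟎 𝟏 : Series
𝟎 = const 0₃
𝟏 = const 1₃

private
  module F = CommutativeRing 𝔽₃-commutativeRing

-- Opaque, since otherwise S ⊕ T unfolds to coefficients and unification fails.
opaque
  _⊕_ _⊗_ : Series → Series → Series
  (S ⊕ T) n = S n +₃ T n

  -- The Cauchy product, computed by writing the left factor as S(0) + q · `tail S`.
  (S ⊗ T) zero    = S 0 *₃ T 0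
  (S ⊗ T) (suc n) = S 0 *₃ T (suc n) +₃ (tail S ⊗ T) n

  ⊖_ : Series → Series
  (⊖ S) n = -₃ S n

  𝟎-coeff : ∀ n → 𝟎 n ≡ 0₃
  𝟎-coeff zero    = refl
  𝟎-coeff (suc n) = refl

  ⊗-cong′ : ∀ {S S′ T T′} → (∀ n → S n ≡ S′ n) → (∀ n → T n ≡ T′ n) →
            ∀ n → (S ⊗ T) n ≡ (S′ ⊗ T′) n
  ⊗-cong′ S≡ T≡ zero    = cong₂ _*₃_ (S≡ 0) (T≡ 0)
  ⊗-cong′ S≡ T≡ (suc n) =
    cong₂ _+₃_ (cong₂ _*₃_ (S≡ 0) (T≡ (suc n))) (⊗-cong′ (λ k → S≡ (suc k)) T≡ n)

  ⊗-zeroˡ′ : ∀ {S} T → (∀ n → S n ≡ 0₃) → ∀ n → (S ⊗ T) n ≡ 0₃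
  ⊗-zeroˡ′ T S≡0 zero    rewrite S≡0 0 = refl
  ⊗-zeroˡ′ T S≡0 (suc n) rewrite S≡0 0 = ⊗-zeroˡ′ T (λ k → S≡0 (suc k)) n

  ⊗-scale : ∀ c S T n → ((λ k → c *₃ S k) ⊗ T) n ≡ c *₃ (S ⊗ T) n
  ⊗-scale c S T zero    = F.*-assoc c (S 0) (T 0)
  ⊗-scale c S T (suc n) rewrite ⊗-scale c (tail S) T n =
    solve 4 (λ c s t p → c :* s :* t :+ c :* p := c :* (s :* t :+ p)) refl
      c (S 0) (T (suc n)) ((tail S ⊗ T) n)
    where open 𝔽₃-Solver

  ⊗-distribʳ′ : ∀ U S T n → ((S ⊕ T) ⊗ U) n ≡ (S ⊗ U) n +₃ (T ⊗ U) n
  ⊗-distribʳ′ U S T zero    = F.distribʳ (U 0) (S 0) (T 0)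
  ⊗-distribʳ′ U S T (suc n) rewrite ⊗-distribʳ′ U (tail S) (tail T) n =
    solve 5 (λ s t u p q → (s :+ t) :* u :+ (p :+ q) := (s :* u :+ p) :+ (t :* u :+ q)) refl
      (S 0) (T 0) (U (suc n)) ((tail S ⊗ U) n) ((tail T ⊗ U) n)
    where open 𝔽₃-Solver

  -- By definition the tail of `S ⊗ T` is S(0) · `tail T` + `tail S ⊗ T`, so distributivity and
  -- `⊗-scale` reduce the claim to `tail S`.
  ⊗-assoc′ : ∀ S T U n → ((S ⊗ T) ⊗ U) n ≡ (S ⊗ (T ⊗ U)) n
  ⊗-assoc′ S T U zero    = F.*-assoc (S 0) (T 0) (U 0)
  ⊗-assoc′ S T U (suc n)
    rewrite ⊗-distribʳ′ U (λ k → S 0 *₃ T (suc k)) (tail S ⊗ T) n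
          | ⊗-scale (S 0) (tail T) U n | ⊗-assoc′ (tail S) T U n =
    solve 5 (λ s t u p q → s :* t :* u :+ (s :* p :+ q) := s :* (t :* u :+ p) :+ q) refl
      (S 0) (T 0) (U (suc n)) ((tail T ⊗ U) n) ((tail S ⊗ (T ⊗ U)) n)
    where open 𝔽₃-Solver

  -- The mirror image of the defining recursion, peeling the right factor instead of the left;
  -- commutativity follows by comparing the two.
  ⊗-sucʳ : ∀ S T n → (S ⊗ T) (suc n) ≡ S (suc n) *₃ T 0 +₃ (S ⊗ tail T) n
  ⊗-sucʳ S T zero    = F.+-comm (S 0 *₃ T 1) (S 1 *₃ T 0)
  ⊗-sucʳ S T (suc n) rewrite ⊗-sucʳ (tail S) T n =
    solve 3 (λ x y z → x :+ (y :+ z) := y :+ (x :+ z)) refl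
      (S 0 *₃ T (suc (suc n))) (S (suc (suc n)) *₃ T 0) ((tail S ⊗ tail T) n)
    where open 𝔽₃-Solver

  ⊗-comm′ : ∀ S T n → (S ⊗ T) n ≡ (T ⊗ S) n
  ⊗-comm′ S T zero    = F.*-comm (S 0) (T 0)
  ⊗-comm′ S T (suc n) rewrite ⊗-sucʳ T S n | ⊗-comm′ (tail S) T n | F.*-comm (S 0) (T (suc n)) = refl

  ⊗-identityˡ′ : ∀ S n → (𝟏 ⊗ S) n ≡ S n
  ⊗-identityˡ′ S zero    = refl
  ⊗-identityˡ′ S (suc n) rewrite ⊗-zeroˡ′ {S = tail 𝟏} S (λ _ → refl) n = F.+-identityʳ (S (suc n))

  Series-isCommutativeRing : IsCommutativeRing _≈_ _⊕_ _⊗_ ⊖_ 𝟎 𝟏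
  Series-isCommutativeRing = record
    { isRing = record
      { +-isAbelianGroup = record
        { isGroup = record
          { isMonoid = record
            { isSemigroup = record
              { isMagma = record
                { isEquivalence = record
                  { refl  = coeffwise λ _ → refl
                  ; sym   = λ p → coeffwise λ n → sym (coeff p n)
                  ; trans = λ p q → coeffwise λ n → trans (coeff p n) (coeff q n)
                  }
                ; ∙-cong = λ p q → coeffwise λ n → cong₂ _+₃_ (coeff p n) (coeff q n)
                }
              ; assoc = λ S T U → coeffwise λ n → F.+-assoc (S n) (T n) (U n)
              }
            ; identity = (λ S → coeffwise λ n → cong (_+₃ S n) (𝟎-coeff n))
                       , (λ S → coeffwise λ n →
                            trans (cong (S n +₃_) (𝟎-coeff n)) (F.+-identityʳ (S n)))
            }
          ; inverse = (λ S → coeffwise λ n → trans (F.-‿inverseˡ (S n)) (sym (𝟎-coeff n)))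
                    , (λ S → coeffwise λ n → trans (F.-‿inverseʳ (S n)) (sym (𝟎-coeff n)))
          ; ⁻¹-cong = λ p → coeffwise λ n → cong -₃_ (coeff p n)
          }
        ; comm = λ S T → coeffwise λ n → F.+-comm (S n) (T n)
        }
      ; *-cong = λ p q → coeffwise (⊗-cong′ (coeff p) (coeff q))
      ; *-assoc = λ S T U → coeffwise (⊗-assoc′ S T U)
      ; *-identity = (λ S → coeffwise (⊗-identityˡ′ S))
                   , (λ S → coeffwise λ n → trans (⊗-comm′ S 𝟏 n) (⊗-identityˡ′ S n))
      ; distrib = (λ U S T → coeffwise λ n → trans (⊗-comm′ U (S ⊕ T) n)
                    (trans (⊗-distribʳ′ U S T n) (cong₂ _+₃_ (⊗-comm′ S U n) (⊗-comm′ T U n))))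
                , (λ U S T → coeffwise (⊗-distribʳ′ U S T))
      }
    ; *-comm = λ S T → coeffwise (⊗-comm′ S T)
    }

Series-commutativeRing : CommutativeRing 0ℓ 0ℓ
Series-commutativeRing = record { isCommutativeRing = Series-isCommutativeRing }

open CommutativeRing Series-commutativeRing public
  using (setoid)
  renaming ( refl to ≈-refl; sym to ≈-sym; trans to ≈-trans
           ; +-cong to ⊕-cong; *-cong to ⊗-cong; -‿cong to ⊖-cong; *-assoc to ⊗-assoc
           ; zeroˡ to ⊗-zeroˡ; *-identityˡ to ⊗-identityˡ; *-identityʳ to ⊗-identityʳ)

opaque
  unfolding _⊕_

  const-⊕ : ∀ c d n → const (c +₃ d) n ≡ (const c ⊕ const d) n
  const-⊕ c d zero    = refl
  const-⊕ c d (suc n) = refl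

  const-⊖ : ∀ c n → const (-₃ c) n ≡ (⊖ const c) n
  const-⊖ c zero    = refl
  const-⊖ c (suc n) = refl

  const-⊗ : ∀ c d n → const (c *₃ d) n ≡ (const c ⊗ const d) n
  const-⊗ c d zero    = refl
  const-⊗ c d (suc n) rewrite ⊗-zeroˡ′ {S = tail (const c)} (const d) (λ _ → refl) n
    = sym (trans (F.+-identityʳ (c *₃ 0₃)) (F.zeroʳ c))

const-homomorphism : CommutativeRing.rawRing 𝔽₃-commutativeRing -Raw-AlmostCommutative⟶
                     fromCommutativeRing Series-commutativeRing
const-homomorphism = record
  { ⟦_⟧    = const
  ; +-homo = λ c d → coeffwise (const-⊕ c d)
  ; *-homo = λ c d → coeffwise (const-⊗ c d)
  ; -‿homo = λ c → coeffwise (const-⊖ c)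
  ; 0-homo = ≈-refl
  ; 1-homo = ≈-refl
  }

const-≟ : WeaklyDecidable (Induced-equivalence const-homomorphism)
const-≟ c d with c ≟ d
... | yes refl = just ≈-refl
... | no _     = nothing

-- Taking the coefficients of polynomials in 𝔽₃ makes the solver aware of 3 = 0.
module Series-Solver = RingSolver (CommutativeRing.rawRing 𝔽₃-commutativeRing)
  (fromCommutativeRing Series-commutativeRing) const-homomorphism const-≟

open Series-Solver using (solve; con; _:+_; _:*_; :-_; _:=_)

≡⇒≈ : ∀ {S T} → S ≡ T → S ≈ T
≡⇒≈ refl = ≈-refl

-- Monomials and the substitutions q ↦ q² and q ↦ q³

shift : Series → Series
shift S zero    = 0₃
shift S (suc n) = S n

X : ℕ → Series
X zero    = 𝟏
X (suc k) = shift (X k)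

shift-cong : ∀ {S T} → S ≈ T → shift S ≈ shift T
shift-cong p = coeffwise λ { zero → refl ; (suc n) → coeff p n }

opaque
  unfolding _⊕_

  shift-⊗ : ∀ S T → shift S ⊗ T ≈ shift (S ⊗ T)
  shift-⊗ S T = coeffwise λ { zero → refl ; (suc n) → refl }

X-+ : ∀ m n → X (m + n) ≈ X m ⊗ X n
X-+ zero    n = ≈-sym (⊗-identityˡ (X n))
X-+ (suc m) n = ≈-trans (shift-cong (X-+ m n)) (≈-sym (shift-⊗ (X m) (X n)))

X-cong : ∀ {m n} → m ≡ n → X m ≈ X n
X-cong p = ≡⇒≈ (cong X p)

shift≈X⊗ : ∀ S → shift S ≈ X 1 ⊗ S
shift≈X⊗ S = ≈-sym (≈-trans (shift-⊗ 𝟏 S) (shift-cong (⊗-identityˡ S)))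

-- The substitutions q ↦ q² and q ↦ q³.
D E : Series → Series
D S zero          = S 0
D S (suc zero)    = 0₃
D S (suc (suc n)) = D (tail S) n

E S zero                = S 0
E S (suc zero)          = 0₃
E S (suc (suc zero))    = 0₃
E S (suc (suc (suc n))) = E (tail S) n

opaque
  unfolding _⊕_

  D-cong′ : ∀ {S T} → (∀ n → S n ≡ T n) → ∀ n → D S n ≡ D T n
  D-cong′ p zero          = p 0
  D-cong′ p (suc zero)    = refl
  D-cong′ p (suc (suc n)) = D-cong′ (λ k → p (suc k)) n

  D-⊕′ : ∀ S T n → D (S ⊕ T) n ≡ D S n +₃ D T n
  D-⊕′ S T zero          = refl
  D-⊕′ S T (suc zero)    = refl
  D-⊕′ S T (suc (suc n)) = D-⊕′ (tail S) (tail T) n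

  D-⊖′ : ∀ S n → D (⊖ S) n ≡ -₃ D S n
  D-⊖′ S zero          = refl
  D-⊖′ S (suc zero)    = refl
  D-⊖′ S (suc (suc n)) = D-⊖′ (tail S) n

  D-scale : ∀ c S n → D (λ k → c *₃ S k) n ≡ c *₃ D S n
  D-scale c S zero          = refl
  D-scale c S (suc zero)    = sym (F.zeroʳ c)
  D-scale c S (suc (suc n)) = D-scale c (tail S) n

  D-⊗′ : ∀ S T n → D (S ⊗ T) n ≡ (D S ⊗ D T) n
  D-⊗′ S T zero          = refl
  D-⊗′ S T (suc zero)    = sym (trans (F.+-identityʳ (S 0 *₃ 0₃)) (F.zeroʳ (S 0)))
  D-⊗′ S T (suc (suc n)) = trans (D-⊕′ (λ k → S 0 *₃ T (suc k)) (tail S ⊗ T) n)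
    (cong₂ _+₃_ (D-scale (S 0) (tail T) n) (D-⊗′ (tail S) T n))

  D-zero : ∀ {S} → (∀ n → S n ≡ 0₃) → ∀ n → D S n ≡ 0₃
  D-zero p zero          = p 0
  D-zero p (suc zero)    = refl
  D-zero p (suc (suc n)) = D-zero (λ k → p (suc k)) n

  D-cong : ∀ {S T} → S ≈ T → D S ≈ D T
  D-cong p = coeffwise (D-cong′ (coeff p))

  D-⊕ : ∀ S T → D (S ⊕ T) ≈ D S ⊕ D T
  D-⊕ S T = coeffwise (D-⊕′ S T)

  D-⊖ : ∀ S → D (⊖ S) ≈ ⊖ D S
  D-⊖ S = coeffwise (D-⊖′ S)

  D-⊗ : ∀ S T → D (S ⊗ T) ≈ D S ⊗ D T
  D-⊗ S T = coeffwise (D-⊗′ S T)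

  D-𝟏 : D 𝟏 ≈ 𝟏
  D-𝟏 = coeffwise λ { zero → refl ; (suc zero) → refl ; (suc (suc n)) → D-zero (λ _ → refl) n }

D-shift : ∀ S → D (shift S) ≈ shift (shift (D S))
D-shift S = coeffwise λ { zero → refl ; (suc zero) → refl ; (suc (suc n)) → refl }

D-X : ∀ k → D (X k) ≈ X (k * 2)
D-X zero    = D-𝟏
D-X (suc k) = ≈-trans (D-shift (X k)) (shift-cong (shift-cong (D-X k)))

infix 9 _³
_³ : Series → Series
S ³ = S ⊗ S ⊗ S

³-cong : ∀ {S T} → S ≈ T → S ³ ≈ T ³
³-cong p = ⊗-cong (⊗-cong p p) p

opaque
  unfolding _⊕_

  const+shift : ∀ S → S ≈ const (S 0) ⊕ X 1 ⊗ tail S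
  const+shift S = ≈-trans
    (coeffwise λ { zero → sym (F.+-identityʳ (S 0)) ; (suc n) → refl })
    (⊕-cong (≈-refl {const (S 0)}) (shift≈X⊗ (tail S)))

  const-cube : ∀ c → const c ³ ≈ const c
  const-cube 0₃ = solve 0 (con 0₃ :* con 0₃ :* con 0₃ := con 0₃) ≈-refl
  const-cube 1₃ = solve 0 (con 1₃ :* con 1₃ :* con 1₃ := con 1₃) ≈-refl
  const-cube 2₃ = solve 0 (con 2₃ :* con 2₃ :* con 2₃ := con 2₃) ≈-refl

  -- Frobenius in characteristic 3: (c + q t)³ = c³ + q³ t³, and c³ = c in 𝔽₃. This is the recursion
  -- that defines `E`.
  ³-step : ∀ S → S ³ ≈ const (S 0) ⊕ shift (shift (shift (tail S ³)))
  ³-step S = begin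
    S ³                                               ≈⟨ ³-cong (const+shift S) ⟩
    (const (S 0) ⊕ X 1 ⊗ tail S) ³
      ≈⟨ solve 3 (λ c x t → let u = c :+ x :* t in
           u :* u :* u := c :* c :* c :+ x :* (x :* (x :* (t :* t :* t)))) ≈-refl
           (const (S 0)) (X 1) (tail S) ⟩
    const (S 0) ³ ⊕ X 1 ⊗ (X 1 ⊗ (X 1 ⊗ tail S ³))
      ≈⟨ ⊕-cong (const-cube (S 0)) (≈-sym (≈-trans (shift≈X⊗ _) (⊗-cong ≈-refl
           (≈-trans (shift≈X⊗ _) (⊗-cong ≈-refl (shift≈X⊗ (tail S ³))))))) ⟩
    const (S 0) ⊕ shift (shift (shift (tail S ³)))    ∎
    where open SetoidReasoning setoid

  E≈³′ : ∀ S n → E S n ≡ (S ³) n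
  E≈³′ S zero                = sym (trans (coeff (³-step S) 0) (F.+-identityʳ (S 0)))
  E≈³′ S (suc zero)          = sym (coeff (³-step S) 1)
  E≈³′ S (suc (suc zero))    = sym (coeff (³-step S) 2)
  E≈³′ S (suc (suc (suc n))) =
    trans (E≈³′ (tail S) n) (sym (coeff (³-step S) (suc (suc (suc n)))))

-- From here `E` inherits congruence, additivity and multiplicativity from cubing, whereas those of
-- `D` are proved coefficient by coefficient.
E≈³ : ∀ S → E S ≈ S ³
E≈³ S = coeffwise (E≈³′ S)

E-cong : ∀ {S T} → S ≈ T → E S ≈ E T
E-cong {S} {T} p = ≈-trans (E≈³ S) (≈-trans (³-cong p) (≈-sym (E≈³ T)))

E-⊕ : ∀ S T → E (S ⊕ T) ≈ E S ⊕ E T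
E-⊕ S T = ≈-trans (E≈³ (S ⊕ T)) (≈-trans
  (solve 2 (λ s t → (s :+ t) :* (s :+ t) :* (s :+ t) := s :* s :* s :+ t :* t :* t) ≈-refl S T)
  (≈-sym (⊕-cong (E≈³ S) (E≈³ T))))

E-⊗ : ∀ S T → E (S ⊗ T) ≈ E S ⊗ E T
E-⊗ S T = ≈-trans (E≈³ (S ⊗ T)) (≈-trans
  (solve 2 (λ s t → s :* t :* (s :* t) :* (s :* t) := s :* s :* s :* (t :* t :* t)) ≈-refl S T)
  (≈-sym (⊗-cong (E≈³ S) (E≈³ T))))

E-⊖ : ∀ S → E (⊖ S) ≈ ⊖ E S
E-⊖ S = ≈-trans (E≈³ (⊖ S)) (≈-trans
  (solve 1 (λ s → :- s :* :- s :* :- s := :- (s :* s :* s)) ≈-refl S)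
  (⊖-cong (≈-sym (E≈³ S))))

E-𝟏 : E 𝟏 ≈ 𝟏
E-𝟏 = ≈-trans (E≈³ 𝟏) (solve 0 (con 1₃ :* con 1₃ :* con 1₃ := con 1₃) ≈-refl)

E-X : ∀ k → E (X k) ≈ X (k * 3)
E-X zero    = E-𝟏
E-X (suc k) = ≈-trans
  (coeffwise λ { zero → refl ; (suc zero) → refl ; (suc (suc zero)) → refl
               ; (suc (suc (suc n))) → refl })
  (shift-cong (shift-cong (shift-cong (E-X k))))

D-E : ∀ S → D (E S) ≈ E (D S)
D-E S = ≈-trans (D-cong (E≈³ S)) (≈-trans (≈-trans (D-⊗ (S ⊗ S) S) (⊗-cong (D-⊗ S S) ≈-refl))
  (≈-sym (E≈³ (D S))))

-- Sections along the residue classes modulo 3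

sec : Fin 3 → Series → Series
sec r S n = S (n * 3 + toℕ r)

sec-cong : ∀ r {S T} → S ≈ T → sec r S ≈ sec r T
sec-cong r p = coeffwise λ n → coeff p (n * 3 + toℕ r)

opaque
  unfolding _⊕_

  -- Unfolding the product three times meets the coefficients S(0), 0, 0 of `E S` and then
  -- `E (tail S)`; the zero terms compute away.
  sec-E⊗′ : ∀ r S T n → sec r (E S ⊗ T) n ≡ (S ⊗ sec r T) n
  sec-E⊗′ 0₃ S T zero    = refl
  sec-E⊗′ 1₃ S T zero    = F.+-identityʳ (S 0 *₃ T 1)
  sec-E⊗′ 2₃ S T zero    = F.+-identityʳ (S 0 *₃ T 2)
  sec-E⊗′ r  S T (suc n) = cong (S 0 *₃ sec r T (suc n) +₃_) (sec-E⊗′ r (tail S) T n)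

  sec-⊕ : ∀ r S T → sec r (S ⊕ T) ≈ sec r S ⊕ sec r T
  sec-⊕ r S T = coeffwise λ _ → refl

  sec-E⊗ : ∀ r S T → sec r (E S ⊗ T) ≈ S ⊗ sec r T
  sec-E⊗ r S T = coeffwise (sec-E⊗′ r S T)

-- Congruence modulo q^d and cancellation

infix 4 _≈[_]_
record _≈[_]_ (S : Series) (d : ℕ) (T : Series) : Set where
  constructor coeffwise<
  field coeff< : ∀ n → n < d → S n ≡ T n
open _≈[_]_ public

≈⇒≈[] : ∀ {d S T} → S ≈ T → S ≈[ d ] T
≈⇒≈[] p = coeffwise< λ n _ → coeff p n

≈[]-setoid : ℕ → Setoid _ _
≈[]-setoid d = record
  { Carrier = Series
  ; _≈_ = _≈[ d ]_
  ; isEquivalence = record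
    { refl  = ≈⇒≈[] ≈-refl
    ; sym   = λ p → coeffwise< λ n n<d → sym (coeff< p n n<d)
    ; trans = λ p q → coeffwise< λ n n<d → trans (coeff< p n n<d) (coeff< q n n<d)
    }
  }

module _ {d : ℕ} where
  open Setoid (≈[]-setoid d) public
    using () renaming (refl to ≈[]-refl; sym to ≈[]-sym; trans to ≈[]-trans)

≈[]-anti : ∀ {c d S T} → c ≤ d → S ≈[ d ] T → S ≈[ c ] T
≈[]-anti c≤d p = coeffwise< λ n n<c → coeff< p n (<-≤-trans n<c c≤d)

opaque
  unfolding _⊕_

  ⊕-cong[] : ∀ {d S S′ T T′} → S ≈[ d ] S′ → T ≈[ d ] T′ → S ⊕ T ≈[ d ] S′ ⊕ T′
  ⊕-cong[] p q = coeffwise< λ n n<d → cong₂ _+₃_ (coeff< p n n<d) (coeff< q n n<d)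

  ⊖-cong[] : ∀ {d S T} → S ≈[ d ] T → ⊖ S ≈[ d ] ⊖ T
  ⊖-cong[] p = coeffwise< λ n n<d → cong -₃_ (coeff< p n n<d)

  ⊗-cong[]′ : ∀ d {S S′ T T′} → (∀ n → n < d → S n ≡ S′ n) → (∀ n → n < d → T n ≡ T′ n) →
              ∀ n → n < d → (S ⊗ T) n ≡ (S′ ⊗ T′) n
  ⊗-cong[]′ d       p q zero    n<d = cong₂ _*₃_ (p 0 n<d) (q 0 n<d)
  ⊗-cong[]′ (suc d) p q (suc n) n<d = cong₂ _+₃_
    (cong₂ _*₃_ (p 0 (s≤s z≤n)) (q (suc n) n<d))
    (⊗-cong[]′ d (λ k k<d → p (suc k) (s≤s k<d)) (λ k k<d → q k (m<n⇒m<1+n k<d)) n (s≤s⁻¹ n<d))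

  ⊗-cong[] : ∀ {d S S′ T T′} → S ≈[ d ] S′ → T ≈[ d ] T′ → S ⊗ T ≈[ d ] S′ ⊗ T′
  ⊗-cong[] p q = coeffwise< (⊗-cong[]′ _ (coeff< p) (coeff< q))

D-cong[] : ∀ {d S T} → S ≈[ d ] T → D S ≈[ d ] D T
D-cong[] {S = S} {T} p = coeffwise< λ n n<d → go S T n (λ k k≤n → coeff< p k (≤-trans (s≤s k≤n) n<d))
  where
  go : ∀ S T n → (∀ k → k ≤ n → S k ≡ T k) → D S n ≡ D T n
  go S T zero          p = p 0 z≤n
  go S T (suc zero)    p = refl
  go S T (suc (suc n)) p = go (tail S) (tail T) n λ k k≤n → p (suc k) (s≤s (m≤n⇒m≤1+n k≤n))

X≈[]𝟎 : ∀ {d k} → d ≤ k → X k ≈[ d ] 𝟎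
X≈[]𝟎 d≤k = coeffwise< λ n n<d → go n _ (<-≤-trans n<d d≤k)
  where
  go : ∀ n k → n < k → X k n ≡ 𝟎 n
  go zero    (suc k) _   = refl
  go (suc n) (suc k) n<k = trans (go n k (s≤s⁻¹ n<k)) (𝟎-coeff n)

opaque
  unfolding _⊕_

  -- Division by a series with constant term 1: the constant term of the product forces S(0) = 0,
  -- after which the rest of the product is `tail S ⊗ U`, known to vanish to one order less.
  cancel-zero : ∀ d {S U} → U 0 ≡ 1₃ → (∀ n → n < d → (S ⊗ U) n ≡ 0₃) → ∀ n → n < d → S n ≡ 0₃
  cancel-zero (suc d) {S} {U} U₀ p = go
    where
    S₀ : S 0 ≡ 0₃
    S₀ = trans (sym (F.*-identityʳ (S 0))) (trans (cong (S 0 *₃_) (sym U₀)) (p 0 (s≤s z≤n)))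
    go : ∀ n → n < suc d → S n ≡ 0₃
    go zero    _   = S₀
    go (suc n) n<d = cancel-zero d U₀
      (λ k k<d → trans (cong (λ s → s *₃ U (suc k) +₃ (tail S ⊗ U) k) (sym S₀))
                       (p (suc k) (s≤s k<d)))
      n (s≤s⁻¹ n<d)

  ⊗-cancelʳ[] : ∀ {d S T} U → U ≈[ 1 ] 𝟏 → S ⊗ U ≈[ d ] T ⊗ U → S ≈[ d ] T
  ⊗-cancelʳ[] {d} {S} {T} U U≈𝟏 p = coeffwise< λ n n<d → begin
    S n                      ≡⟨ sym (F.+-identityʳ (S n)) ⟩
    S n +₃ 0₃                ≡⟨ cong (S n +₃_) (sym (F.-‿inverseˡ (T n))) ⟩
    S n +₃ (-₃ T n +₃ T n)   ≡⟨ sym (F.+-assoc (S n) (-₃ T n) (T n)) ⟩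
    (S ⊕ ⊖ T) n +₃ T n       ≡⟨ cong (_+₃ T n) (cancel-zero d (coeff< U≈𝟏 0 (s≤s z≤n)) difference n n<d) ⟩
    T n                      ∎
    where
    open ≡-Reasoning
    difference : ∀ n → n < d → ((S ⊕ ⊖ T) ⊗ U) n ≡ 0₃
    difference n n<d = begin
      ((S ⊕ ⊖ T) ⊗ U) n
        ≡⟨ coeff (solve 3 (λ s t u → (s :+ :- t) :* u := s :* u :+ :- (t :* u)) ≈-refl S T U) n ⟩
      (S ⊗ U) n +₃ -₃ (T ⊗ U) n  ≡⟨ cong (_+₃ -₃ (T ⊗ U) n) (coeff< p n n<d) ⟩
      (T ⊗ U) n +₃ -₃ (T ⊗ U) n  ≡⟨ F.-‿inverseʳ ((T ⊗ U) n) ⟩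
      0₃                         ∎

≈[]⇒≈ : ∀ {S T} → (∀ d → S ≈[ d ] T) → S ≈ T
≈[]⇒≈ p = coeffwise λ n → coeff< (p (suc n)) n ≤-refl

⊗-cancelʳ : ∀ {S T} U → U ≈[ 1 ] 𝟏 → S ⊗ U ≈ T ⊗ U → S ≈ T
⊗-cancelʳ U U≈𝟏 p = ≈[]⇒≈ λ d → ⊗-cancelʳ[] U U≈𝟏 (≈⇒≈[] p)

⊗-unit : ∀ {S T} → S ≈[ 1 ] 𝟏 → T ≈[ 1 ] 𝟏 → S ⊗ T ≈[ 1 ] 𝟏
⊗-unit p q = ≈[]-trans (⊗-cong[] p q) (≈⇒≈[] (⊗-identityˡ 𝟏))

-- Convergence in the q-adic topology

infix 4 _⟶_
_⟶_ : (ℕ → Series) → Series → Set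
S ⟶ L = ∀ d → ∃ λ N → ∀ k → N ≤ k → S k ≈[ d ] L

-- The passage from finite to infinite identities: one sequence of partial products or sums is given
-- two limits.
⟶-unique : ∀ {S L M} → S ⟶ L → S ⟶ M → L ≈ M
⟶-unique p q = ≈[]⇒≈ λ d → let (N , f) = p d ; (N′ , g) = q d in
  ≈[]-trans (≈[]-sym (f (N ⊔ N′) (m≤m⊔n N N′))) (g (N ⊔ N′) (m≤n⊔m N N′))

⟶-resp : ∀ {S T L} → (∀ k → S k ≈ T k) → S ⟶ L → T ⟶ L
⟶-resp S≈T p d = let (N , f) = p d in
  N , λ k N≤k → ≈[]-trans (≈⇒≈[] (≈-sym (S≈T k))) (f k N≤k)

⟶-const : ∀ L → (λ _ → L) ⟶ L
⟶-const L d = 0 , λ _ _ → ≈[]-refl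

⟶-⊗ : ∀ {S T L M} → S ⟶ L → T ⟶ M → (λ k → S k ⊗ T k) ⟶ L ⊗ M
⟶-⊗ p q d = let (N , f) = p d ; (N′ , g) = q d in
  N ⊔ N′ , λ k h → ⊗-cong[] (f k (≤-trans (m≤m⊔n N N′) h)) (g k (≤-trans (m≤n⊔m N N′) h))

⟶-⊕ : ∀ {S T L M} → S ⟶ L → T ⟶ M → (λ k → S k ⊕ T k) ⟶ L ⊕ M
⟶-⊕ p q d = let (N , f) = p d ; (N′ , g) = q d in
  N ⊔ N′ , λ k h → ⊕-cong[] (f k (≤-trans (m≤m⊔n N N′) h)) (g k (≤-trans (m≤n⊔m N N′) h))

⟶-D : ∀ {S L} → S ⟶ L → (λ k → D (S k)) ⟶ D L
⟶-D p d = let (N , f) = p d in N , λ k h → D-cong[] (f k h)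

⟶-E : ∀ {S L} → S ⟶ L → (λ k → E (S k)) ⟶ E L
⟶-E {S} {L} p d = let (N , f) = ⟶-⊗ (⟶-⊗ p p) p d in
  N , λ k h → ≈[]-trans (≈⇒≈[] (E≈³ (S k))) (≈[]-trans (f k h) (≈⇒≈[] (≈-sym (E≈³ L))))

⟶-subsequence : ∀ {S L} (φ : ℕ → ℕ) → (∀ k → k ≤ φ k) → S ⟶ L → (λ k → S (φ k)) ⟶ L
⟶-subsequence φ k≤φk p d = let (N , f) = p d in
  N , λ k h → f (φ k) (≤-trans h (k≤φk k))

-- Meaningful only for sequences with S (suc k) ≈[ k ] S k.
lim : (ℕ → Series) → Series
lim S n = S (suc n) n

-- Coefficient `n` of `S k` no longer changes from `k = suc n` on, the index at which `lim` reads
-- it.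
lim-agree : ∀ {S} → (∀ k → S (suc k) ≈[ k ] S k) → ∀ {d k} → d ≤ k → S k ≈[ d ] lim S
lim-agree {S} stable {k = k} d≤k = coeffwise< λ n n<d →
  trans (cong (λ j → S j n) (sym (m∸n+n≡m (≤-trans n<d d≤k)))) (go n (k ∸ suc n))
  where
  go : ∀ n i → S (i + suc n) n ≡ lim S n
  go n zero    = refl
  go n (suc i) = trans (coeff< (stable (i + suc n)) n (m≤n+m (suc n) i)) (go n i)

⟶-lim : ∀ {S} → (∀ k → S (suc k) ≈[ k ] S k) → S ⟶ lim S
⟶-lim stable d = d , λ k → lim-agree stable

-- The Jacobi triple product

∏ : (ℕ → Series) → ℕ → Series
∏ u zero    = 𝟏
∏ u (suc n) = ∏ u n ⊗ u n

∏-stable : ∀ {u} → (∀ k → u k ≈[ k ] 𝟏) → ∀ k → ∏ u (suc k) ≈[ k ] ∏ u k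
∏-stable {u} u≈𝟏 k = ≈[]-trans (⊗-cong[] ≈[]-refl (u≈𝟏 k)) (≈⇒≈[] (⊗-identityʳ (∏ u k)))

∏-unit : ∀ {u} → (∀ k → u k ≈[ 1 ] 𝟏) → ∀ n → ∏ u n ≈[ 1 ] 𝟏
∏-unit u≈𝟏 zero    = ≈[]-refl
∏-unit u≈𝟏 (suc n) = ⊗-unit (∏-unit u≈𝟏 n) (u≈𝟏 n)

1-X : ℕ → Series
1-X k = 𝟏 ⊕ ⊖ X k

1-X≈[]𝟏 : ∀ {d k} → d ≤ k → 1-X k ≈[ d ] 𝟏
1-X≈[]𝟏 d≤k = ≈[]-trans (⊕-cong[] ≈[]-refl (⊖-cong[] (X≈[]𝟎 d≤k)))
  (≈⇒≈[] (solve 0 (con 1₃ :+ :- con 0₃ := con 1₃) ≈-refl))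

1-X-cong : ∀ {m n} → m ≡ n → 1-X m ≈ 1-X n
1-X-cong p = ≡⇒≈ (cong 1-X p)

poch : ℕ → ℕ → ℕ → Series
poch c M = ∏ λ m → 1-X (c + m * M)

poch∞ : ℕ → ℕ → Series
poch∞ c M = lim (poch c M)

module _ (c M : ℕ) .{{_ : NonZero M}} where

  poch-stable : ∀ k → poch c M (suc k) ≈[ k ] poch c M k
  poch-stable = ∏-stable λ k → 1-X≈[]𝟏 (≤-trans (m≤m*n k M) (m≤n+m (k * M) c))

  poch⟶ : poch c M ⟶ poch∞ c M
  poch⟶ = ⟶-lim poch-stable

poch-unit : ∀ c M .{{_ : NonZero c}} n → poch c M n ≈[ 1 ] 𝟏
poch-unit c M = ∏-unit λ n → 1-X≈[]𝟏 (≤-trans (>-nonZero⁻¹ c) (m≤m+n c (n * M)))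

poch∞-unit : ∀ c M .{{_ : NonZero c}} .{{_ : NonZero M}} → poch∞ c M ≈[ 1 ] 𝟏
poch∞-unit c M = ≈[]-trans (≈[]-sym (lim-agree (poch-stable c M) ≤-refl)) (poch-unit c M 1)

Array : Set
Array = ℕ → ℕ → Series

-- Summing over pairs with i + j = n keeps both lower entries of a binomial coefficient at hand
-- without subtraction.
antidiagonal : Array → ℕ → Series
antidiagonal t zero    = t 0 0
antidiagonal t (suc n) = t (suc n) 0 ⊕ antidiagonal (λ i j → t i (suc j)) n

antidiagonal-cong[] : ∀ {d t u} n → (∀ i j → i + j ≡ n → t i j ≈[ d ] u i j) →
                      antidiagonal t n ≈[ d ] antidiagonal u n
antidiagonal-cong[] zero    p = p 0 0 refl
antidiagonal-cong[] (suc n) p = ⊕-cong[] (p (suc n) 0 (cong suc (+-identityʳ n)))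
  (antidiagonal-cong[] n λ i j i+j≡n → p i (suc j) (trans (+-suc i j) (cong suc i+j≡n)))

antidiagonal-cong : ∀ {t u} n → (∀ i j → i + j ≡ n → t i j ≈ u i j) →
                    antidiagonal t n ≈ antidiagonal u n
antidiagonal-cong n p = ≈[]⇒≈ λ d → antidiagonal-cong[] n λ i j i+j≡n → ≈⇒≈[] (p i j i+j≡n)

antidiagonal-⊕ : ∀ t u n → antidiagonal (λ i j → t i j ⊕ u i j) n ≈ antidiagonal t n ⊕ antidiagonal u n
antidiagonal-⊕ t u zero    = ≈-refl
antidiagonal-⊕ t u (suc n) = ≈-trans
  (⊕-cong ≈-refl (antidiagonal-⊕ (λ i j → t i (suc j)) (λ i j → u i (suc j)) n))
  (solve 4 (λ a b c d → a :+ b :+ (c :+ d) := a :+ c :+ (b :+ d)) ≈-refl _ _ _ _)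

antidiagonal-⊗ : ∀ S t n → antidiagonal (λ i j → t i j ⊗ S) n ≈ antidiagonal t n ⊗ S
antidiagonal-⊗ S t zero    = ≈-refl
antidiagonal-⊗ S t (suc n) = ≈-trans
  (⊕-cong ≈-refl (antidiagonal-⊗ S (λ i j → t i (suc j)) n))
  (solve 3 (λ a b s → a :* s :+ b :* s := (a :+ b) :* s) ≈-refl _ _ _)

antidiagonal-last : ∀ t n → antidiagonal t (suc n) ≈ antidiagonal (λ i j → t (suc i) j) n ⊕ t 0 (suc n)
antidiagonal-last t zero    = ≈-refl
antidiagonal-last t (suc n) = ≈-trans
  (⊕-cong ≈-refl (antidiagonal-last (λ i j → t i (suc j)) n))
  (solve 3 (λ a b c → a :+ (b :+ c) := a :+ b :+ c) ≈-refl _ _ _)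

down right : Array → Array
down u zero    j = 𝟎
down u (suc i) j = u i j

right v i zero    = 𝟎
right v i (suc j) = v i j

-- The induction step of a binomial theorem: each entry of the longer antidiagonal draws on its
-- neighbours with `i` or `j` one less, and the zero padding of `down` and `right` covers the two
-- ends.
antidiagonal-split : ∀ {t} u v n →
  (∀ i j → i + j ≡ suc n → t i j ≈ down u i j ⊕ right v i j) →
  antidiagonal t (suc n) ≈ antidiagonal u n ⊕ antidiagonal v n
antidiagonal-split {t} u v n p = begin
  antidiagonal t (suc n)
    ≈⟨ antidiagonal-cong (suc n) p ⟩
  antidiagonal (λ i j → down u i j ⊕ right v i j) (suc n)
    ≈⟨ antidiagonal-⊕ (down u) (right v) (suc n) ⟩
  antidiagonal (down u) (suc n) ⊕ antidiagonal (right v) (suc n)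
    ≈⟨ ⊕-cong (antidiagonal-last (down u) n) ≈-refl ⟩
  (antidiagonal u n ⊕ 𝟎) ⊕ (𝟎 ⊕ antidiagonal v n)
    ≈⟨ solve 2 (λ a b → a :+ con 0₃ :+ (con 0₃ :+ b) := a :+ b) ≈-refl _ _ ⟩
  antidiagonal u n ⊕ antidiagonal v n ∎
  where open SetoidReasoning setoid

module QBinomial (M : ℕ) .{{_ : NonZero M}} where

  -- The Gaussian binomial coefficient [ i + j choose j ] in the variable q ^ M.
  B : Array
  B zero    j       = 𝟏
  B (suc i) zero    = 𝟏
  B (suc i) (suc j) = B i (suc j) ⊕ X (suc i * M) ⊗ B (suc i) j

  P : ℕ → Series
  P = poch M M

  P∞ : Series
  P∞ = poch∞ M M

  B-zeroʳ : ∀ i → B i 0 ≈ 𝟏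
  B-zeroʳ zero    = ≈-refl
  B-zeroʳ (suc i) = ≈-refl

  private
    1-X-+ : ∀ i j → 1-X (suc (i + suc j) * M) ≈ 𝟏 ⊕ ⊖ (X (suc i * M) ⊗ X (suc j * M))
    1-X-+ i j = ⊕-cong ≈-refl (⊖-cong (≈-trans
      (X-cong (ℕ-solve 3 (λ i j m →
         (κ 1 ⊞ (i ⊞ (κ 1 ⊞ j))) ⊠ m ≐ (κ 1 ⊞ i) ⊠ m ⊞ (κ 1 ⊞ j) ⊠ m) refl i j M))
      (X-+ (suc i * M) (suc j * M))))

  -- The quotient formula for Gaussian binomials, cleared of denominators. With x = q^((i+1)M) and y
  -- = q^((j+1)M) the recursion matches 1 - xy = (1 - x) + x (1 - y).
  B-poch : ∀ i j → B i j ⊗ (P i ⊗ P j) ≈ P (i + j)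
  B-poch zero    j       = solve 1 (λ p → con 1₃ :* (con 1₃ :* p) := p) ≈-refl (P j)
  B-poch (suc i) zero    = ≈-trans
    (solve 1 (λ p → con 1₃ :* (p :* con 1₃) := p) ≈-refl (P (suc i)))
    (≡⇒≈ (cong P (sym (+-identityʳ (suc i)))))
  B-poch (suc i) (suc j) = begin
    (B i (suc j) ⊕ x ⊗ B (suc i) j) ⊗ (P i ⊗ (𝟏 ⊕ ⊖ x) ⊗ (P j ⊗ (𝟏 ⊕ ⊖ y)))
      ≈⟨ solve 6 (λ b c x y p r →
           (b :+ x :* c) :* (p :* (con 1₃ :+ :- x) :* (r :* (con 1₃ :+ :- y))) :=
           (con 1₃ :+ :- x) :* (b :* (p :* (r :* (con 1₃ :+ :- y)))) :+
           x :* (con 1₃ :+ :- y) :* (c :* (p :* (con 1₃ :+ :- x) :* r)))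
           ≈-refl (B i (suc j)) (B (suc i) j) x y (P i) (P j) ⟩
    (𝟏 ⊕ ⊖ x) ⊗ (B i (suc j) ⊗ (P i ⊗ P (suc j))) ⊕ x ⊗ (𝟏 ⊕ ⊖ y) ⊗ (B (suc i) j ⊗ (P (suc i) ⊗ P j))
      ≈⟨ ⊕-cong (⊗-cong ≈-refl (B-poch i (suc j)))
           (⊗-cong ≈-refl (≈-trans (B-poch (suc i) j) (≡⇒≈ (cong P (sym (+-suc i j)))))) ⟩
    (𝟏 ⊕ ⊖ x) ⊗ P (i + suc j) ⊕ x ⊗ (𝟏 ⊕ ⊖ y) ⊗ P (i + suc j)
      ≈⟨ solve 3 (λ x y p → (con 1₃ :+ :- x) :* p :+ x :* (con 1₃ :+ :- y) :* p :=
           p :* (con 1₃ :+ :- (x :* y))) ≈-refl x y (P (i + suc j)) ⟩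
    P (i + suc j) ⊗ (𝟏 ⊕ ⊖ (x ⊗ y))
      ≈⟨ ⊗-cong ≈-refl (≈-sym (1-X-+ i j)) ⟩
    P (suc i + suc j) ∎
    where
    open SetoidReasoning setoid
    x = X (suc i * M)
    y = X (suc j * M)

  -- The other Pascal rule, from the other splitting 1 - xy = (1 - x) y + (1 - y) once the
  -- denominators are cleared by `B-poch`.
  B-pascal : ∀ i j → B (suc i) (suc j) ≈ X (suc j * M) ⊗ B i (suc j) ⊕ B (suc i) j
  B-pascal i j = ⊗-cancelʳ (P (suc i) ⊗ P (suc j)) (⊗-unit (poch-unit M M (suc i)) (poch-unit M M (suc j))) (begin
    B (suc i) (suc j) ⊗ (P (suc i) ⊗ P (suc j))    ≈⟨ B-poch (suc i) (suc j) ⟩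
    P (suc i + suc j)                            ≈⟨ ⊗-cong ≈-refl (1-X-+ i j) ⟩
    R ⊗ (𝟏 ⊕ ⊖ (x ⊗ y))
      ≈⟨ solve 3 (λ x y r → r :* (con 1₃ :+ :- (x :* y)) :=
           (con 1₃ :+ :- x) :* y :* r :+ (con 1₃ :+ :- y) :* r) ≈-refl x y R ⟩
    (𝟏 ⊕ ⊖ x) ⊗ y ⊗ R ⊕ (𝟏 ⊕ ⊖ y) ⊗ R
      ≈⟨ ≈-sym (⊕-cong (⊗-cong ≈-refl (B-poch i (suc j)))
           (⊗-cong ≈-refl (≈-trans (B-poch (suc i) j) (≡⇒≈ (cong P (sym (+-suc i j))))))) ⟩
    (𝟏 ⊕ ⊖ x) ⊗ y ⊗ (B i (suc j) ⊗ (P i ⊗ P (suc j))) ⊕ (𝟏 ⊕ ⊖ y) ⊗ (B (suc i) j ⊗ (P (suc i) ⊗ P j))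
      ≈⟨ solve 6 (λ b c x y p r →
           (con 1₃ :+ :- x) :* y :* (b :* (p :* (r :* (con 1₃ :+ :- y)))) :+
           (con 1₃ :+ :- y) :* (c :* (p :* (con 1₃ :+ :- x) :* r)) :=
           (y :* b :+ c) :* (p :* (con 1₃ :+ :- x) :* (r :* (con 1₃ :+ :- y))))
           ≈-refl (B i (suc j)) (B (suc i) j) x y (P i) (P j) ⟩
    (y ⊗ B i (suc j) ⊕ B (suc i) j) ⊗ (P (suc i) ⊗ P (suc j)) ∎)
    where
    open SetoidReasoning setoid
    x = X (suc i * M)
    y = X (suc j * M)
    R = P (i + suc j)

  -- For large `i` and `j` the formula `B-poch` reads `B i j ⊗ (P∞ ⊗ P∞)` = `P∞` modulo q^d, and one
  -- `P∞` cancels.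
  B-limit : ∀ {d i j} → d ≤ i → d ≤ j → B i j ⊗ P∞ ≈[ d ] 𝟏
  B-limit {d} {i} {j} d≤i d≤j = ⊗-cancelʳ[] P∞ (poch∞-unit M M) (begin
    B i j ⊗ P∞ ⊗ P∞      ≈⟨ ≈⇒≈[] (⊗-assoc (B i j) P∞ P∞) ⟩
    B i j ⊗ (P∞ ⊗ P∞)    ≈⟨ ⊗-cong[] ≈[]-refl (⊗-cong[] (P≈ d≤i) (P≈ d≤j)) ⟨
    B i j ⊗ (P i ⊗ P j)  ≈⟨ ≈⇒≈[] (B-poch i j) ⟩
    P (i + j)          ≈⟨ P≈ (≤-trans d≤i (m≤m+n i j)) ⟩
    P∞                   ≈⟨ ≈⇒≈[] (⊗-identityˡ P∞) ⟨
    𝟏 ⊗ P∞               ∎)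
    where
    open SetoidReasoning (≈[]-setoid d)
    P≈ : ∀ {k} → d ≤ k → P k ≈[ d ] P∞
    P≈ = lim-agree (poch-stable M M)

-- The triple product Σ (-1)ⁿ zⁿ q^(M n (n - 1) / 2) = (z; q^M)∞ (q^M / z; q^M)∞ (q^M; q^M)∞ at z =
-- q^α, where q^M / z = q^β.
module JacobiTripleProduct (α β : ℕ) .{{_ : NonZero α}} .{{_ : NonZero (α + β)}} .{{_ : NonZero β}} where

  M : ℕ
  M = α + β

  open QBinomial M

  -- (-1)ⁿ q ^ (M n (n - 1) / 2 + c n), so that term α n and term β n are the
  -- terms of the theta series with indices n and - n.
  term : ℕ → ℕ → Series
  term c zero    = 𝟏
  term c (suc n) = ⊖ (X (c + n * M) ⊗ term c n)

  -- The term with index j - b, an integer that the recursion never has to form.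
  w : ℕ → ℕ → Series
  w j       zero    = term α j
  w zero    (suc b) = term β (suc b)
  w (suc j) (suc b) = w j b

  w-zero : ∀ b → w 0 b ≡ term β b
  w-zero zero    = refl
  w-zero (suc b) = refl

  -- From index m = j - b to m + 1 a term gains the factor -q^(α + m M), and i + j = a + b gives α +
  -- a M = i M + (α + m M).
  w-sucˡ : ∀ i j a b → i + j ≡ a + b →
           ⊖ (X (α + a * M) ⊗ w j b) ≈ X (i * M) ⊗ w (suc j) b
  w-sucˡ i j a zero i+j≡a+0 = begin
    ⊖ (X (α + a * M) ⊗ term α j)
      ≈⟨ ⊖-cong (⊗-cong (≈-trans (X-cong lemma) (X-+ (i * M) (α + j * M))) ≈-refl) ⟩
    ⊖ (X (i * M) ⊗ X (α + j * M) ⊗ term α j)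
      ≈⟨ solve 3 (λ x y z → :- (x :* y :* z) := x :* :- (y :* z)) ≈-refl _ _ _ ⟩
    X (i * M) ⊗ term α (suc j) ∎
    where
    open SetoidReasoning setoid
    lemma : α + a * M ≡ i * M + (α + j * M)
    lemma rewrite trans (sym (+-identityʳ a)) (sym i+j≡a+0) =
      ℕ-solve 4 (λ α m i j → α ⊞ (i ⊞ j) ⊠ m ≐ i ⊠ m ⊞ (α ⊞ j ⊠ m)) refl α M i j
  w-sucˡ i zero a (suc b) i+0≡a+b = begin
    ⊖ (X (α + a * M) ⊗ ⊖ (X (β + b * M) ⊗ term β b))
      ≈⟨ solve 3 (λ x y z → :- (x :* :- (y :* z)) := x :* y :* z) ≈-refl _ _ _ ⟩
    X (α + a * M) ⊗ X (β + b * M) ⊗ term β b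
      ≈⟨ ⊗-cong (≈-trans (≈-sym (X-+ (α + a * M) (β + b * M))) (X-cong lemma))
           (≡⇒≈ (sym (w-zero b))) ⟩
    X (i * M) ⊗ w 0 b ∎
    where
    open SetoidReasoning setoid
    lemma : α + a * M + (β + b * M) ≡ i * M
    lemma rewrite trans (sym (+-identityʳ i)) i+0≡a+b =
      ℕ-solve 4 (λ α β a b → (α ⊞ a ⊠ (α ⊞ β)) ⊞ (β ⊞ b ⊠ (α ⊞ β)) ≐ (a ⊞ (κ 1 ⊞ b)) ⊠ (α ⊞ β))
        refl α β a b
  w-sucˡ i (suc j) a (suc b) eq =
    w-sucˡ i j a b (cong pred (trans (sym (+-suc i j)) (trans eq (+-suc a b))))

  -- From index m = j - b to m - 1 a term gains the factor -q^(β - m M), and β + b M = j M + (β - m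
  -- M).
  w-sucʳ : ∀ j b → ⊖ (X (β + b * M) ⊗ w j b) ≈ X (j * M) ⊗ w j (suc b)
  w-sucʳ zero    b rewrite w-zero b = ≈-sym (⊗-identityˡ (term β (suc b)))
  w-sucʳ (suc j) zero = begin
    ⊖ (X (β + 0) ⊗ ⊖ (X (α + j * M) ⊗ term α j))
      ≈⟨ solve 3 (λ x y z → :- (x :* :- (y :* z)) := x :* y :* z) ≈-refl _ _ _ ⟩
    X (β + 0) ⊗ X (α + j * M) ⊗ term α j
      ≈⟨ ⊗-cong (≈-trans (≈-sym (X-+ (β + 0) (α + j * M))) (X-cong
           (ℕ-solve 3 (λ α β x → (β ⊞ κ 0) ⊞ (α ⊞ x) ≐ (α ⊞ β) ⊞ x) refl α β (j * M)))) ≈-refl ⟩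
    X (suc j * M) ⊗ term α j ∎
    where open SetoidReasoning setoid
  w-sucʳ (suc j) (suc b) = begin
    ⊖ (X (β + suc b * M) ⊗ w j b)
      ≈⟨ ⊖-cong (⊗-cong (≈-trans (X-cong
           (ℕ-solve 3 (λ β m x → β ⊞ (m ⊞ x) ≐ m ⊞ (β ⊞ x)) refl β M (b * M)))
           (X-+ M (β + b * M))) ≈-refl) ⟩
    ⊖ (X M ⊗ X (β + b * M) ⊗ w j b)
      ≈⟨ solve 3 (λ x y z → :- (x :* y :* z) := x :* :- (y :* z)) ≈-refl _ _ _ ⟩
    X M ⊗ ⊖ (X (β + b * M) ⊗ w j b)
      ≈⟨ ⊗-cong ≈-refl (w-sucʳ j b) ⟩
    X M ⊗ (X (j * M) ⊗ w j (suc b))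
      ≈⟨ ≈-trans (≈-sym (⊗-assoc (X M) _ _)) (⊗-cong (≈-sym (X-+ M (j * M))) ≈-refl) ⟩
    X (suc j * M) ⊗ w j (suc b) ∎
    where open SetoidReasoning setoid

  summand : ℕ → Array
  summand b i j = w j b ⊗ B i j

  -- The finite triple product, a form of the q-binomial theorem. A new factor on the α side is
  -- absorbed by the defining recursion of `B`; one on the β side moves the centre `b` and is
  -- absorbed by `B-pascal`.
  jacobi-finite : ∀ a b → poch α M a ⊗ poch β M b ≈ antidiagonal (summand b) (a + b)
  jacobi-finite zero zero = ≈-refl
  jacobi-finite (suc a) b = begin
    poch α M a ⊗ y ⊗ poch β M b
      ≈⟨ solve 3 (λ p y r → p :* y :* r := p :* r :* y) ≈-refl _ _ _ ⟩
    poch α M a ⊗ poch β M b ⊗ y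
      ≈⟨ ⊗-cong (jacobi-finite a b) ≈-refl ⟩
    S ⊗ y
      ≈⟨ solve 2 (λ s x → s :* (con 1₃ :+ :- x) := s :+ s :* :- x) ≈-refl S x ⟩
    S ⊕ S ⊗ ⊖ x
      ≈⟨ ⊕-cong ≈-refl (≈-sym (antidiagonal-⊗ (⊖ x) (summand b) n)) ⟩
    S ⊕ antidiagonal v n
      ≈⟨ ≈-sym (antidiagonal-split (summand b) v n split) ⟩
    antidiagonal (summand b) (suc n) ∎
    where
    open SetoidReasoning setoid
    n = a + b
    x = X (α + a * M)
    y = 1-X (α + a * M)
    S = antidiagonal (summand b) n
    v : Array
    v i j = summand b i j ⊗ ⊖ x
    v≈ : ∀ i j → i + j ≡ n → v i j ≈ X (i * M) ⊗ w (suc j) b ⊗ B i j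
    v≈ i j eq = ≈-trans
      (solve 3 (λ w b x → w :* b :* :- x := :- (x :* w) :* b) ≈-refl (w j b) (B i j) x)
      (⊗-cong (w-sucˡ i j a b eq) ≈-refl)
    split : ∀ i j → i + j ≡ suc n → summand b i j ≈ down (summand b) i j ⊕ right v i j
    split (suc i) zero eq = ≈-trans (⊗-cong ≈-refl (≈-sym (B-zeroʳ i)))
      (solve 1 (λ s → s := s :+ con 0₃) ≈-refl _)
    split zero (suc j) eq = ≈-trans
      (solve 1 (λ s → s :* con 1₃ := con 0₃ :+ con 1₃ :* s :* con 1₃) ≈-refl (w (suc j) b))
      (⊕-cong ≈-refl (≈-sym (v≈ 0 j (cong pred eq))))
    split (suc i) (suc j) eq = ≈-trans
      (solve 4 (λ w b x c → w :* (b :+ x :* c) := w :* b :+ x :* w :* c) ≈-refl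
        (w (suc j) b) (B i (suc j)) (X (suc i * M)) (B (suc i) j))
      (⊕-cong ≈-refl (≈-sym (v≈ (suc i) j (trans (sym (+-suc i j)) (cong pred eq)))))
  jacobi-finite zero (suc b) = begin
    𝟏 ⊗ (poch β M b ⊗ y)
      ≈⟨ ≈-sym (⊗-assoc 𝟏 (poch β M b) y) ⟩
    𝟏 ⊗ poch β M b ⊗ y
      ≈⟨ ⊗-cong (jacobi-finite zero b) ≈-refl ⟩
    S ⊗ y
      ≈⟨ solve 2 (λ s x → s :* (con 1₃ :+ :- x) := s :* :- x :+ s) ≈-refl S x ⟩
    S ⊗ ⊖ x ⊕ S
      ≈⟨ ⊕-cong (≈-sym (antidiagonal-⊗ (⊖ x) (summand b) b)) ≈-refl ⟩
    antidiagonal u b ⊕ S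
      ≈⟨ ≈-sym (antidiagonal-split u (summand b) b split) ⟩
    antidiagonal (summand (suc b)) (suc b) ∎
    where
    open SetoidReasoning setoid
    x = X (β + b * M)
    y = 1-X (β + b * M)
    S = antidiagonal (summand b) b
    u : Array
    u i j = summand b i j ⊗ ⊖ x
    u≈ : ∀ i j → u i j ≈ X (j * M) ⊗ w j (suc b) ⊗ B i j
    u≈ i j = ≈-trans
      (solve 3 (λ w b x → w :* b :* :- x := :- (x :* w) :* b) ≈-refl (w j b) (B i j) x)
      (⊗-cong (w-sucʳ j b) ≈-refl)
    split : ∀ i j → i + j ≡ suc b → summand (suc b) i j ≈ down u i j ⊕ right (summand b) i j
    split (suc i) zero eq = ≈-trans
      (≈-trans (solve 1 (λ s → s :* con 1₃ := con 1₃ :* s :* con 1₃ :+ con 0₃) ≈-refl (w 0 (suc b)))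
        (⊕-cong (⊗-cong ≈-refl (≈-sym (B-zeroʳ i))) ≈-refl))
      (⊕-cong (≈-sym (u≈ i 0)) ≈-refl)
    split zero (suc j) eq = solve 1 (λ s → s := con 0₃ :+ s) ≈-refl _
    split (suc i) (suc j) eq = ≈-trans (⊗-cong ≈-refl (B-pascal i j)) (≈-trans
      (solve 4 (λ w b x c → w :* (x :* b :+ c) := x :* w :* b :+ w :* c) ≈-refl
        (w j b) (B i (suc j)) (X (suc j * M)) (B (suc i) j))
      (⊕-cong (≈-sym (u≈ i (suc j))) ≈-refl))

  θ-partial : ℕ → Series
  θ-partial zero    = 𝟏
  θ-partial (suc n) = θ-partial n ⊕ (term α (suc n) ⊕ term β (suc n))

  θ : Series
  θ = lim θ-partial

  term≈[]𝟎 : ∀ {d} c n .{{_ : NonZero c}} → d ≤ n → term c n ≈[ d ] 𝟎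
  term≈[]𝟎 {zero}  c n       d≤n = coeffwise< λ _ ()
  term≈[]𝟎 {suc d} c (suc n) d≤n = ≈[]-trans
    (⊖-cong[] (⊗-cong[] (X≈[]𝟎 (≤-trans d≤n (+-mono-≤ (>-nonZero⁻¹ c) (m≤m*n n M)))) ≈[]-refl))
    (≈⇒≈[] (solve 1 (λ t → :- (con 0₃ :* t) := con 0₃) ≈-refl (term c n)))

  θ-stable : ∀ k → θ-partial (suc k) ≈[ k ] θ-partial k
  θ-stable k = ≈[]-trans
    (⊕-cong[] ≈[]-refl (⊕-cong[] (term≈[]𝟎 α (suc k) (<⇒≤ (n<1+n k))) (term≈[]𝟎 β (suc k) (<⇒≤ (n<1+n k)))))
    (≈⇒≈[] (solve 1 (λ s → s :+ (con 0₃ :+ con 0₃) := s) ≈-refl (θ-partial k)))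

  θ-partial⟶ : θ-partial ⟶ θ
  θ-partial⟶ = ⟶-lim θ-stable

  w-+ : ∀ k n → w (k + n) n ≡ term α k
  w-+ k zero    = cong (term α) (+-identityʳ k)
  w-+ k (suc n) = trans (cong (λ j → w j (suc n)) (+-suc k n)) (w-+ k n)

  -- The index j - n runs from -n to n; the induction step adds the two extreme terms, one at each
  -- end of the antidiagonal.
  antidiagonal-w : ∀ n → antidiagonal (λ _ j → w j n) (n + n) ≈ θ-partial n
  antidiagonal-w zero    = ≈-refl
  antidiagonal-w (suc n) rewrite +-suc n n = begin
    term β (suc n) ⊕ antidiagonal (λ _ j → w j n) (suc (n + n))
      ≈⟨ ⊕-cong ≈-refl (antidiagonal-last (λ _ j → w j n) (n + n)) ⟩
    term β (suc n) ⊕ (antidiagonal (λ _ j → w j n) (n + n) ⊕ w (suc n + n) n)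
      ≈⟨ ⊕-cong ≈-refl (⊕-cong (antidiagonal-w n) (≡⇒≈ (w-+ (suc n) n))) ⟩
    term β (suc n) ⊕ (θ-partial n ⊕ term α (suc n))
      ≈⟨ solve 3 (λ b p a → b :+ (p :+ a) := p :+ (a :+ b)) ≈-refl _ _ _ ⟩
    θ-partial (suc n) ∎
    where open SetoidReasoning setoid

  w≈[]𝟎ˡ : ∀ {d} j b → d + b ≤ j → w j b ≈[ d ] 𝟎
  w≈[]𝟎ˡ {d} j zero h = term≈[]𝟎 α j (≤-trans (≤-reflexive (sym (+-identityʳ d))) h)
  w≈[]𝟎ˡ {d} (suc j) (suc b) h = w≈[]𝟎ˡ j b (s≤s⁻¹ (≤-trans (≤-reflexive (sym (+-suc d b))) h))
  w≈[]𝟎ˡ {d} zero (suc b) h with () ← ≤-trans (≤-reflexive (sym (+-suc d b))) h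

  w≈[]𝟎ʳ : ∀ {d} j b → d + j ≤ b → w j b ≈[ d ] 𝟎
  w≈[]𝟎ʳ {d} zero b h rewrite w-zero b = term≈[]𝟎 β b (≤-trans (≤-reflexive (sym (+-identityʳ d))) h)
  w≈[]𝟎ʳ {d} (suc j) (suc b) h = w≈[]𝟎ʳ j b (s≤s⁻¹ (≤-trans (≤-reflexive (sym (+-suc d j))) h))
  w≈[]𝟎ʳ {d} (suc j) zero h with () ← ≤-trans (≤-reflexive (sym (+-suc d j))) h

  private
    negligible : ∀ {d} n i j → w j n ≈[ d ] 𝟎 → summand n i j ⊗ P∞ ≈[ d ] w j n
    negligible n i j p = ≈[]-trans (⊗-cong[] (⊗-cong[] p ≈[]-refl) ≈[]-refl)
      (≈[]-trans (≈⇒≈[] (solve 2 (λ b p → con 0₃ :* b :* p := con 0₃) ≈-refl (B i j) P∞)) (≈[]-sym p))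

    -- If `i` and `j` are both at least `d`, `B-limit` applies. Otherwise `d + d ≤ n` puts the index
    -- j - n at distance at least d from 0, so the term itself vanishes modulo q^d.
    summand-limit : ∀ {d n} → d + d ≤ n → ∀ i j → i + j ≡ n + n →
                    summand n i j ⊗ P∞ ≈[ d ] w j n
    summand-limit {d} {n} 2d≤n i j i+j≡2n with ≤-<-connex d i | ≤-<-connex d j
    ... | inj₁ d≤i | inj₁ d≤j = ≈[]-trans (≈⇒≈[] (⊗-assoc (w j n) (B i j) P∞))
      (≈[]-trans (⊗-cong[] ≈[]-refl (B-limit d≤i d≤j)) (≈⇒≈[] (⊗-identityʳ (w j n))))
    ... | inj₁ _ | inj₂ j<d = negligible n i j
      (w≈[]𝟎ʳ j n (≤-trans (+-monoʳ-≤ d (<⇒≤ j<d)) 2d≤n))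
    ... | inj₂ i<d | _ = negligible n i j
      (w≈[]𝟎ˡ j n (+-cancelʳ-≤ i (d + n) j (begin
        d + n + i ≤⟨ +-monoʳ-≤ (d + n) (<⇒≤ i<d) ⟩
        d + n + d ≡⟨ ℕ-solve 2 (λ d n → d ⊞ n ⊞ d ≐ d ⊞ d ⊞ n) refl d n ⟩
        d + d + n ≤⟨ +-mono-≤ 2d≤n ≤-refl ⟩
        n + n       ≡⟨ sym i+j≡2n ⟩
        i + j       ≡⟨ ℕ-solve 2 (λ i j → i ⊞ j ≐ j ⊞ i) refl i j ⟩
        j + i       ∎)))
      where open ≤-Reasoning

  -- Multiplying the finite identity with a = b = n by `P∞` turns every relevant Gaussian binomial
  -- into 1 in the limit.
  jacobi : θ ≈ poch∞ α M ⊗ poch∞ β M ⊗ P∞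
  jacobi = ⟶-unique
    (λ d → d + d , λ n 2d≤n → let open SetoidReasoning (≈[]-setoid d) in begin
      poch α M n ⊗ poch β M n ⊗ P∞
        ≈⟨ ≈⇒≈[] (⊗-cong (jacobi-finite n n) ≈-refl) ⟩
      antidiagonal (summand n) (n + n) ⊗ P∞
        ≈⟨ ≈⇒≈[] (≈-sym (antidiagonal-⊗ P∞ (summand n) (n + n))) ⟩
      antidiagonal (λ i j → summand n i j ⊗ P∞) (n + n)
        ≈⟨ antidiagonal-cong[] (n + n) (summand-limit 2d≤n) ⟩
      antidiagonal (λ _ j → w j n) (n + n)
        ≈⟨ ≈⇒≈[] (antidiagonal-w n) ⟩
      θ-partial n
        ≈⟨ lim-agree θ-stable (≤-trans (m≤m+n d d) 2d≤n) ⟩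
      θ ∎)
    (⟶-⊗ (⟶-⊗ (poch⟶ α M) (poch⟶ β M)) (⟶-const P∞))

-- The generating function of dp

residue : ℕ → 𝔽₃
residue zero    = 0₃
residue (suc n) = next (residue n)

residue-+ : ∀ m n → residue (m + n) ≡ residue m +₃ residue n
residue-+ zero    n = refl
residue-+ (suc m) n = trans (cong next (residue-+ m n)) (next-+ (residue m) (residue n))
  where
  next-+ : ∀ x y → next (x +₃ y) ≡ next x +₃ y
  next-+ 0₃ y  = refl
  next-+ 1₃ y  = refl
  next-+ 2₃ 0₃ = refl
  next-+ 2₃ 1₃ = refl
  next-+ 2₃ 2₃ = refl

residue≡0⇒%3≡0 : ∀ n → residue n ≡ 0₃ → n % 3 ≡ 0
residue≡0⇒%3≡0 zero                _ = refl
residue≡0⇒%3≡0 (suc (suc (suc n))) p = residue≡0⇒%3≡0 n (trans (sym (next³ (residue n))) p)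
  where
  next³ : ∀ x → next (next (next x)) ≡ x
  next³ 0₃ = refl
  next³ 1₃ = refl
  next³ 2₃ = refl

isAllowed : ℕ → Bool
isAllowed k = does (allowed? k)

-- 12 is the least common multiple of 4 and 6, and the remainders of 12 + k compute to those of k,
-- so the induction step is definitional.
isAllowed-periodic : ∀ r n → isAllowed (n * 12 + r) ≡ isAllowed r
isAllowed-periodic r zero    = refl
isAllowed-periodic r (suc n) = isAllowed-periodic r n

-- Parts are positive, so a length bound of at least `n` is mere fuel. Removing a part lowers fuel
-- and sum by different amounts, which `G≤-suc` must reconcile.
partitions≤-stable : ∀ {ℓ ℓ′} m n → n ≤ ℓ → n ≤ ℓ′ → partitions≤ ℓ m n ≡ partitions≤ ℓ′ m n
partitions≤-stable m zero    _ _ = refl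
partitions≤-stable {suc ℓ} {suc ℓ′} m (suc n) n≤ℓ n≤ℓ′ = concatMap-cong
  (λ i → cong (map (suc i ∷_)) (partitions≤-stable (suc i) (n ∸ i)
    (≤-trans (m∸n≤m n i) (s≤s⁻¹ n≤ℓ)) (≤-trans (m∸n≤m n i) (s≤s⁻¹ n≤ℓ′))))
  (upTo (m ⊓ suc n))

concatMap-∷ʳ : ∀ {A B : Set} (f : A → List B) xs x → concatMap f (xs ∷ʳ x) ≡ concatMap f xs ++ f x
concatMap-∷ʳ f xs x = begin
  concat (map f (xs ∷ʳ x))          ≡⟨ cong concat (map-++ f xs [ x ]) ⟩
  concat (map f xs ++ f x ∷ [])     ≡⟨ sym (concat-++ (map f xs) (f x ∷ [])) ⟩
  concatMap f xs ++ (f x ++ [])     ≡⟨ cong (concatMap f xs ++_) (++-identityʳ (f x)) ⟩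
  concatMap f xs ++ f x             ∎
  where open ≡-Reasoning

countAllowed : List (List ℕ) → ℕ
countAllowed xs = length (filter (all? allowed?) xs)

countAllowed-++ : ∀ xs ys → countAllowed (xs ++ ys) ≡ countAllowed xs + countAllowed ys
countAllowed-++ xs ys = trans (cong length (filter-++ (all? allowed?) xs ys))
  (length-++ (filter (all? allowed?) xs))

countAllowed-∷ : ∀ k xs → countAllowed (map (k ∷_) xs) ≡ (if isAllowed k then countAllowed xs else 0)
countAllowed-∷ k [] with isAllowed k
... | true  = refl
... | false = refl
countAllowed-∷ k (x ∷ xs) with isAllowed k | countAllowed-∷ k xs
... | false | ih = ih
... | true  | ih with does (all? allowed? x)
...   | true  = cong suc ih
...   | false = ih

G≤ : ℕ → Series
G≤ m n = residue (countAllowed (partitions≤ n m n))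

largest : ℕ → Series
largest m = if isAllowed (suc m) then X (suc m) else 𝟎

opaque
  unfolding _⊕_

  shift-coeff : ∀ k S n → k ≤ n → (X k ⊗ S) n ≡ S (n ∸ k)
  shift-coeff zero    S n       _   = coeff (⊗-identityˡ S) n
  shift-coeff (suc k) S (suc n) k≤n = shift-coeff k S n (s≤s⁻¹ k≤n)

  shift-coeff-0 : ∀ k S n → n < k → (X k ⊗ S) n ≡ 0₃
  shift-coeff-0 (suc k) S zero    _   = refl
  shift-coeff-0 (suc k) S (suc n) n<k = shift-coeff-0 k S n (s≤s⁻¹ n<k)

  -- A partition either has no part `suc m`, or loses one such part and may still contain others;
  -- hence `G≤ (suc m)` also on the right. For `n < m` such a part exceeds the sum `suc n`, and the
  -- last term vanishes.
  G≤-suc : ∀ m → G≤ (suc m) ≈ G≤ m ⊕ largest m ⊗ G≤ (suc m)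
  G≤-suc m = coeffwise go
    where
    open ≡-Reasoning
    go : ∀ n → G≤ (suc m) n ≡ G≤ m n +₃ (largest m ⊗ G≤ (suc m)) n
    go zero with isAllowed (suc m)
    ... | true  = refl
    ... | false = refl
    go (suc n) with ≤-<-connex m n
    ... | inj₂ n<m = trans (cong (λ k → residue (countAllowed (concatMap f (upTo k)))) eq)
      (trans (sym (F.+-identityʳ _)) (cong (G≤ m (suc n) +₃_) (sym zero-term)))
      where
      f : ℕ → List (List ℕ)
      f i = map (suc i ∷_) (partitions≤ n (suc i) (n ∸ i))
      eq : suc m ⊓ suc n ≡ m ⊓ suc n
      eq = trans (m≥n⇒m⊓n≡n (s≤s (<⇒≤ n<m))) (sym (m≥n⇒m⊓n≡n n<m))
      zero-term : (largest m ⊗ G≤ (suc m)) (suc n) ≡ 0₃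
      zero-term with isAllowed (suc m)
      ... | true  = shift-coeff-0 (suc m) (G≤ (suc m)) (suc n) (s≤s n<m)
      ... | false = trans (coeff (⊗-zeroˡ (G≤ (suc m))) (suc n)) refl
    ... | inj₁ m≤n = begin
      residue (countAllowed (concatMap f (upTo (suc m ⊓ suc n))))
        ≡⟨ cong (λ k → residue (countAllowed (concatMap f (upTo k)))) (m≤n⇒m⊓n≡m (s≤s m≤n)) ⟩
      residue (countAllowed (concatMap f (upTo (suc m))))
        ≡⟨ cong (λ is → residue (countAllowed (concatMap f is))) (sym (upTo-∷ʳ m)) ⟩
      residue (countAllowed (concatMap f (upTo m ∷ʳ m)))
        ≡⟨ cong (λ xs → residue (countAllowed xs)) (concatMap-∷ʳ f (upTo m) m) ⟩
      residue (countAllowed (concatMap f (upTo m) ++ f m))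
        ≡⟨ trans (cong residue (countAllowed-++ (concatMap f (upTo m)) (f m)))
             (residue-+ (countAllowed (concatMap f (upTo m))) (countAllowed (f m))) ⟩
      residue (countAllowed (concatMap f (upTo m))) +₃ residue (countAllowed (f m))
        ≡⟨ cong₂ _+₃_ (cong (λ k → residue (countAllowed (concatMap f (upTo k))))
             (sym (m≤n⇒m⊓n≡m (m≤n⇒m≤1+n m≤n)))) last-term ⟩
      G≤ m (suc n) +₃ (largest m ⊗ G≤ (suc m)) (suc n) ∎
      where
      f : ℕ → List (List ℕ)
      f i = map (suc i ∷_) (partitions≤ n (suc i) (n ∸ i))
      last-term : residue (countAllowed (f m)) ≡ (largest m ⊗ G≤ (suc m)) (suc n)
      last-term rewrite countAllowed-∷ (suc m) (partitions≤ n (suc m) (n ∸ m)) with isAllowed (suc m)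
      ... | true  = trans (cong (λ ps → residue (countAllowed ps))
                      (partitions≤-stable {n} {n ∸ m} (suc m) (n ∸ m) (m∸n≤m n m) ≤-refl))
                    (sym (shift-coeff (suc m) (G≤ (suc m)) (suc n) (s≤s m≤n)))
      ... | false = sym (coeff (⊗-zeroˡ (G≤ (suc m))) (suc n))

factor : Bool → ℕ → Series
factor b k = if b then 1-X k else 𝟏

allowedFactor : ℕ → Series
allowedFactor m = factor (isAllowed (suc m)) (suc m)

G≤-step : ∀ m → G≤ (suc m) ⊗ allowedFactor m ≈ G≤ m
G≤-step m = begin
  G≤ (suc m) ⊗ allowedFactor m
    ≈⟨ ⊗-cong ≈-refl allowedFactor≈ ⟩
  G≤ (suc m) ⊗ (𝟏 ⊕ ⊖ largest m)
    ≈⟨ solve 2 (λ g x → g :* (con 1₃ :+ :- x) := g :+ :- (x :* g)) ≈-refl (G≤ (suc m)) (largest m) ⟩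
  G≤ (suc m) ⊕ ⊖ (largest m ⊗ G≤ (suc m))
    ≈⟨ ⊕-cong (G≤-suc m) ≈-refl ⟩
  G≤ m ⊕ largest m ⊗ G≤ (suc m) ⊕ ⊖ (largest m ⊗ G≤ (suc m))
    ≈⟨ solve 2 (λ g x → g :+ x :+ :- x := g) ≈-refl (G≤ m) (largest m ⊗ G≤ (suc m)) ⟩
  G≤ m ∎
  where
  open SetoidReasoning setoid
  allowedFactor≈ : allowedFactor m ≈ 𝟏 ⊕ ⊖ largest m
  allowedFactor≈ with isAllowed (suc m)
  ... | true  = ≈-refl
  ... | false = solve 0 (con 1₃ := con 1₃ :+ :- con 0₃) ≈-refl

G≤-inverse : ∀ m → G≤ m ⊗ ∏ allowedFactor m ≈ 𝟏
G≤-inverse zero    = ≈-trans (⊗-identityʳ (G≤ 0)) (coeffwise λ { zero → refl ; (suc n) → refl })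
G≤-inverse (suc m) = begin
  G≤ (suc m) ⊗ (∏ allowedFactor m ⊗ allowedFactor m)
    ≈⟨ solve 3 (λ g p u → g :* (p :* u) := g :* u :* p) ≈-refl _ _ _ ⟩
  G≤ (suc m) ⊗ allowedFactor m ⊗ ∏ allowedFactor m
    ≈⟨ ⊗-cong (G≤-step m) ≈-refl ⟩
  G≤ m ⊗ ∏ allowedFactor m
    ≈⟨ G≤-inverse m ⟩
  𝟏 ∎
  where open SetoidReasoning setoid

-- One order more than `lim` asks for: `G-coeff` uses it to lower the part bound from `suc n`, read
-- by `lim`, to the `n` of `dp`.
G≤-stable : ∀ k → G≤ (suc k) ≈[ suc k ] G≤ k
G≤-stable k = ≈[]-trans (≈⇒≈[] (G≤-suc k)) (≈[]-trans
  (⊕-cong[] ≈[]-refl (⊗-cong[] largest≈𝟎 ≈[]-refl))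
  (≈⇒≈[] (solve 2 (λ g h → g :+ con 0₃ :* h := g) ≈-refl (G≤ k) (G≤ (suc k)))))
  where
  largest≈𝟎 : largest k ≈[ suc k ] 𝟎
  largest≈𝟎 with isAllowed (suc k)
  ... | true  = X≈[]𝟎 ≤-refl
  ... | false = ≈[]-refl

G : Series
G = lim G≤

G≤⟶ : G≤ ⟶ G
G≤⟶ = ⟶-lim λ k → ≈[]-anti (<⇒≤ (n<1+n k)) (G≤-stable k)

G-coeff : ∀ n → G n ≡ residue (dp n)
G-coeff n = coeff< (G≤-stable n) n ≤-refl

private
  factor-at : ∀ n r → allowedFactor (r + n * 12) ≈ factor (isAllowed (suc r)) (suc r + n * 12)
  factor-at n r = ≡⇒≈ (cong (λ b → factor b (suc r + n * 12)) (lemma r n))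
    where
    lemma : ∀ r n → isAllowed (suc r + n * 12) ≡ isAllowed (suc r)
    lemma r n = trans (cong isAllowed (+-comm (suc r) (n * 12))) (isAllowed-periodic (suc r) n)

-- Twelve consecutive parts contribute 1, 7 and 5, 11 from the classes ±1 modulo 6 and 4, 8, 12 from
-- the multiples of 4. The classes are disjoint, so no factor occurs twice.
∏-allowedFactor : ∀ n → ∏ allowedFactor (n * 12) ≈
                  poch 1 6 (n * 2) ⊗ poch 5 6 (n * 2) ⊗ poch 4 4 (n * 3)
∏-allowedFactor zero = solve 0 (con 1₃ := con 1₃ :* con 1₃ :* con 1₃) ≈-refl
∏-allowedFactor (suc n) rewrite *-assoc n 2 6 | *-assoc n 3 4 = begin
  p ⊗ v 0 ⊗ v 1 ⊗ v 2 ⊗ v 3 ⊗ v 4 ⊗ v 5 ⊗ v 6 ⊗ v 7 ⊗ v 8 ⊗ v 9 ⊗ v 10 ⊗ v 11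
    ≈⟨ ⊗-cong (⊗-cong (⊗-cong (⊗-cong (⊗-cong (⊗-cong (⊗-cong (⊗-cong (⊗-cong (⊗-cong (⊗-cong (⊗-cong
        (∏-allowedFactor n) (at 0)) (at 1)) (at 2)) (at 3)) (at 4)) (at 5)) (at 6)) (at 7)) (at 8))
        (at 9)) (at 10)) (at 11) ⟩
  a ⊗ b ⊗ c ⊗ x 1 ⊗ 𝟏 ⊗ 𝟏 ⊗ x 4 ⊗ x 5 ⊗ 𝟏 ⊗ x 7 ⊗ x 8 ⊗ 𝟏 ⊗ 𝟏 ⊗ x 11 ⊗ x 12
    ≈⟨ solve 10 (λ a b c x₁ x₄ x₅ x₇ x₈ x₁₁ x₁₂ →
         a :* b :* c :* x₁ :* con 1₃ :* con 1₃ :* x₄ :* x₅ :* con 1₃ :* x₇ :* x₈ :* con 1₃ :* con 1₃ :* x₁₁ :* x₁₂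
         := a :* x₁ :* x₇ :* (b :* x₅ :* x₁₁) :* (c :* x₄ :* x₈ :* x₁₂)) ≈-refl
         a b c (x 1) (x 4) (x 5) (x 7) (x 8) (x 11) (x 12) ⟩
  a ⊗ x 1 ⊗ x 7 ⊗ (b ⊗ x 5 ⊗ x 11) ⊗ (c ⊗ x 4 ⊗ x 8 ⊗ x 12) ∎
  where
  open SetoidReasoning setoid
  v x : ℕ → Series
  v r = allowedFactor (r + n * 12)
  x r = 1-X (r + n * 12)
  at : ∀ r → v r ≈ factor (isAllowed (suc r)) (suc r + n * 12)
  at = factor-at n
  p = ∏ allowedFactor (n * 12)
  a = poch 1 6 (n * 2)
  b = poch 5 6 (n * 2)
  c = poch 4 4 (n * 3)

G-product : G ⊗ (poch∞ 1 6 ⊗ poch∞ 5 6 ⊗ poch∞ 4 4) ≈ 𝟏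
G-product = ⟶-unique
  (⟶-⊗ (⟶-subsequence (_* 12) (λ k → m≤m*n k 12) G≤⟶)
    (⟶-⊗ (⟶-⊗ (⟶-subsequence (_* 2) (λ k → m≤m*n k 2) (poch⟶ 1 6))
               (⟶-subsequence (_* 2) (λ k → m≤m*n k 2) (poch⟶ 5 6)))
         (⟶-subsequence (_* 3) (λ k → m≤m*n k 3) (poch⟶ 4 4))))
  (⟶-resp (λ k → ≈-sym (≈-trans (⊗-cong ≈-refl (≈-sym (∏-allowedFactor k))) (G≤-inverse (k * 12))))
    (⟶-const 𝟏))

-- Product identities and dissections

D-1-X : ∀ k → D (1-X k) ≈ 1-X (k * 2)
D-1-X k = ≈-trans (D-⊕ 𝟏 (⊖ X k)) (⊕-cong D-𝟏 (≈-trans (D-⊖ (X k)) (⊖-cong (D-X k))))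

E-1-X : ∀ k → E (1-X k) ≈ 1-X (k * 3)
E-1-X k = ≈-trans (E-⊕ 𝟏 (⊖ X k)) (⊕-cong E-𝟏 (≈-trans (E-⊖ (X k)) (⊖-cong (E-X k))))

private
  scale-index : ∀ k c n M → (c + n * M) * k ≡ c * k + n * (M * k)
  scale-index k c n M = trans (*-distribʳ-+ k c (n * M)) (cong (λ j → c * k + j) (*-assoc n M k))

D-poch : ∀ c M n → D (poch c M n) ≈ poch (c * 2) (M * 2) n
D-poch c M zero    = D-𝟏
D-poch c M (suc n) = ≈-trans (D-⊗ (poch c M n) (1-X (c + n * M)))
  (⊗-cong (D-poch c M n) (≈-trans (D-1-X (c + n * M)) (1-X-cong (scale-index 2 c n M))))

E-poch : ∀ c M n → E (poch c M n) ≈ poch (c * 3) (M * 3) n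
E-poch c M zero    = E-𝟏
E-poch c M (suc n) = ≈-trans (E-⊗ (poch c M n) (1-X (c + n * M)))
  (⊗-cong (E-poch c M n) (≈-trans (E-1-X (c + n * M)) (1-X-cong (scale-index 3 c n M))))

D-poch∞ : ∀ c M .{{_ : NonZero M}} .{{_ : NonZero (M * 2)}} →
          D (poch∞ c M) ≈ poch∞ (c * 2) (M * 2)
D-poch∞ c M = ⟶-unique (⟶-D (poch⟶ c M))
  (⟶-resp (λ n → ≈-sym (D-poch c M n)) (poch⟶ (c * 2) (M * 2)))

E-poch∞ : ∀ c M .{{_ : NonZero M}} .{{_ : NonZero (M * 3)}} →
          E (poch∞ c M) ≈ poch∞ (c * 3) (M * 3)
E-poch∞ c M = ⟶-unique (⟶-E (poch⟶ c M))
  (⟶-resp (λ n → ≈-sym (E-poch c M n)) (poch⟶ (c * 3) (M * 3)))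

f : (k : ℕ) → Series
f k = poch∞ k k

f-unit : ∀ k .{{_ : NonZero k}} → f k ≈[ 1 ] 𝟏
f-unit k = poch∞-unit k k

f₂³≈f₆ : f 2 ³ ≈ f 6
f₂³≈f₆ = ≈-trans (≈-sym (E≈³ (f 2))) (E-poch∞ 2 2)

f₁³≈f₃ : f 1 ³ ≈ f 3
f₁³≈f₃ = ≈-trans (≈-sym (E≈³ (f 1))) (E-poch∞ 1 1)

f₁-split : f 1 ≈ poch∞ 1 2 ⊗ f 2
f₁-split = ⟶-unique
  (⟶-subsequence (_* 2) (λ k → m≤m*n k 2) (poch⟶ 1 1))
  (⟶-resp (λ n → ≈-sym (finite n)) (⟶-⊗ (poch⟶ 1 2) (poch⟶ 2 2)))
  where
  finite : ∀ n → poch 1 1 (n * 2) ≈ poch 1 2 n ⊗ poch 2 2 n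
  finite zero    = ≈-sym (⊗-identityˡ 𝟏)
  finite (suc n) rewrite *-identityʳ (n * 2) = ≈-trans
    (⊗-cong (⊗-cong (finite n) ≈-refl) ≈-refl)
    (solve 4 (λ p r x y → p :* r :* x :* y := p :* x :* (r :* y)) ≈-refl
      (poch 1 2 n) (poch 2 2 n) (1-X (1 + n * 2)) (1-X (2 + n * 2)))

a : Series
a = poch∞ 1 6 ⊗ poch∞ 5 6

-- In each block of six exponents `a` supplies 1, 5, `f 2` supplies 2, 4, 6 and `f 3` supplies 3, 6:
-- every exponent once, and the multiple of 6 once more.
a-relation : a ⊗ f 2 ⊗ f 3 ≈ f 1 ⊗ f 6
a-relation = ⟶-unique
  (⟶-⊗ (⟶-⊗ (⟶-⊗ (poch⟶ 1 6) (poch⟶ 5 6))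
    (⟶-subsequence (_* 3) (λ k → m≤m*n k 3) (poch⟶ 2 2)))
    (⟶-subsequence (_* 2) (λ k → m≤m*n k 2) (poch⟶ 3 3)))
  (⟶-resp (λ n → ≈-sym (finite n))
    (⟶-⊗ (⟶-subsequence (_* 6) (λ k → m≤m*n k 6) (poch⟶ 1 1)) (poch⟶ 6 6)))
  where
  finite : ∀ n → poch 1 6 n ⊗ poch 5 6 n ⊗ poch 2 2 (n * 3) ⊗ poch 3 3 (n * 2) ≈
                 poch 1 1 (n * 6) ⊗ poch 6 6 n
  finite zero    = solve 0 (con 1₃ :* con 1₃ :* con 1₃ :* con 1₃ := con 1₃ :* con 1₃) ≈-refl
  finite (suc n) rewrite *-assoc n 3 2 | *-assoc n 2 3 | *-identityʳ (n * 6) = begin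
    p ⊗ x 1 ⊗ (q ⊗ x 5) ⊗ (r ⊗ x 2 ⊗ x 4 ⊗ x 6) ⊗ (s ⊗ x 3 ⊗ x 6)
      ≈⟨ solve 10 (λ p q r s x₁ x₂ x₃ x₄ x₅ x₆ →
           p :* x₁ :* (q :* x₅) :* (r :* x₂ :* x₄ :* x₆) :* (s :* x₃ :* x₆) :=
           p :* q :* r :* s :* (x₁ :* x₂ :* x₃ :* x₄ :* x₅ :* x₆ :* x₆)) ≈-refl
           p q r s (x 1) (x 2) (x 3) (x 4) (x 5) (x 6) ⟩
    p ⊗ q ⊗ r ⊗ s ⊗ (x 1 ⊗ x 2 ⊗ x 3 ⊗ x 4 ⊗ x 5 ⊗ x 6 ⊗ x 6)
      ≈⟨ ⊗-cong (finite n) ≈-refl ⟩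
    t ⊗ u ⊗ (x 1 ⊗ x 2 ⊗ x 3 ⊗ x 4 ⊗ x 5 ⊗ x 6 ⊗ x 6)
      ≈⟨ solve 8 (λ t u x₁ x₂ x₃ x₄ x₅ x₆ →
           t :* u :* (x₁ :* x₂ :* x₃ :* x₄ :* x₅ :* x₆ :* x₆) :=
           t :* x₁ :* x₂ :* x₃ :* x₄ :* x₅ :* x₆ :* (u :* x₆)) ≈-refl
           t u (x 1) (x 2) (x 3) (x 4) (x 5) (x 6) ⟩
    t ⊗ x 1 ⊗ x 2 ⊗ x 3 ⊗ x 4 ⊗ x 5 ⊗ x 6 ⊗ (u ⊗ x 6) ∎
    where
    open SetoidReasoning setoid
    x : ℕ → Series
    x r = 1-X (r + n * 6)
    p = poch 1 6 n
    q = poch 5 6 n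
    r = poch 2 2 (n * 3)
    s = poch 3 3 (n * 2)
    t = poch 1 1 (n * 6)
    u = poch 6 6 n

-- Theta series and their dissections modulo 3

module J₂ = JacobiTripleProduct 1 1
module J₆ = JacobiTripleProduct 1 5

-- The exponent M n (n - 1) / 2 + α n is n² for M = 2, α = 1 and 3n² - 2n for M = 6, α = 1.
φ Ω : Series
φ = J₂.θ
Ω = J₆.θ

sgn : ℕ → Series
sgn zero    = 𝟏
sgn (suc n) = ⊖ sgn n

private
  signed-step : ∀ {T s e e′} k → T ≈ s ⊗ X e → k + e ≡ e′ → ⊖ (X k ⊗ T) ≈ ⊖ s ⊗ X e′
  signed-step {T} {s} {e} k p refl = ≈-trans (⊖-cong (⊗-cong ≈-refl p)) (≈-trans
    (solve 3 (λ x s y → :- (x :* (s :* y)) := :- s :* (x :* y)) ≈-refl (X k) s (X e))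
    (⊗-cong ≈-refl (≈-sym (X-+ k e))))

  ⊖⊖ : ∀ S → ⊖ ⊖ S ≈ S
  ⊖⊖ = solve 1 (λ s → :- :- s := s) ≈-refl

  sgn-*3 : ∀ n → sgn (n * 3) ≈ sgn n
  sgn-*3 zero    = ≈-refl
  sgn-*3 (suc n) = ⊖-cong (≈-trans (⊖⊖ (sgn (n * 3))) (sgn-*3 n))

  E-sgn : ∀ n → E (sgn n) ≈ sgn n
  E-sgn zero    = E-𝟏
  E-sgn (suc n) = ≈-trans (E-⊖ (sgn n)) (⊖-cong (E-sgn n))

  E-signed : ∀ {T} n e → T ≈ sgn n ⊗ X e → E T ≈ sgn n ⊗ X (e * 3)
  E-signed {T} n e p = ≈-trans (E-cong p) (≈-trans (E-⊗ (sgn n) (X e)) (⊗-cong (E-sgn n) (E-X e)))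

  T : ℕ → Series
  T = J₂.term 1

φ-term : ∀ n → T n ≈ sgn n ⊗ X (n * n)
φ-term zero    = ≈-sym (⊗-identityˡ 𝟏)
φ-term (suc n) = signed-step (1 + n * 2) (φ-term n)
  (ℕ-solve 1 (λ n → κ 1 ⊞ n ⊠ κ 2 ⊞ n ⊠ n ≐ (κ 1 ⊞ n) ⊠ (κ 1 ⊞ n)) refl n)

Ω-term₅ : ∀ n → J₆.term 5 n ≈ sgn n ⊗ X (3 * n * n + 2 * n)
Ω-term₅ zero    = ≈-sym (⊗-identityˡ 𝟏)
Ω-term₅ (suc n) = signed-step (5 + n * 6) (Ω-term₅ n)
  (ℕ-solve 1 (λ n → κ 5 ⊞ n ⊠ κ 6 ⊞ (κ 3 ⊠ n ⊠ n ⊞ κ 2 ⊠ n) ≐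
    κ 3 ⊠ (κ 1 ⊞ n) ⊠ (κ 1 ⊞ n) ⊞ κ 2 ⊠ (κ 1 ⊞ n)) refl n)

-- 3n² + 4n + 1 is 3m² - 2m at m = n + 1, expanded to stay within ℕ.
Ω-term₁ : ∀ n → J₆.term 1 (suc n) ≈ sgn (suc n) ⊗ X (3 * n * n + 4 * n + 1)
Ω-term₁ zero    = signed-step {e = 0} 1 (≈-sym (⊗-identityˡ 𝟏)) refl
Ω-term₁ (suc n) = signed-step (1 + suc n * 6) (Ω-term₁ n)
  (ℕ-solve 1 (λ n → κ 1 ⊞ (κ 1 ⊞ n) ⊠ κ 6 ⊞ (κ 3 ⊠ n ⊠ n ⊞ κ 4 ⊠ n ⊞ κ 1) ≐
    κ 3 ⊠ (κ 1 ⊞ n) ⊠ (κ 1 ⊞ n) ⊞ κ 4 ⊠ (κ 1 ⊞ n) ⊞ κ 1) refl n)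

φ-term-3n : ∀ n → T (n * 3) ≈ E (E (T n))
φ-term-3n n = begin
  T (n * 3)                                 ≈⟨ φ-term (n * 3) ⟩
  sgn (n * 3) ⊗ X (n * 3 * (n * 3))   ≈⟨ ⊗-cong (sgn-*3 n) (X-cong
    (ℕ-solve 1 (λ n → n ⊠ κ 3 ⊠ (n ⊠ κ 3) ≐ n ⊠ n ⊠ κ 3 ⊠ κ 3) refl n)) ⟩
  sgn n ⊗ X (n * n * 3 * 3)             ≈⟨ ≈-sym (E-signed n (n * n * 3) (E-signed n (n * n) (φ-term n))) ⟩
  E (E (T n))                                 ∎
  where open SetoidReasoning setoid

private
  X⊗-signed : ∀ n e → X 1 ⊗ (sgn n ⊗ X e) ≈ sgn n ⊗ X (suc e)
  X⊗-signed n e = ≈-trans (solve 3 (λ x s y → x :* (s :* y) := s :* (x :* y)) ≈-refl (X 1) (sgn n) (X e))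
    (⊗-cong ≈-refl (≈-sym (X-+ 1 e)))

-- (3n + 1)² = 1 + 3 (3n² + 2n), where 3n² + 2n is the exponent of Ω at index -n.
φ-term-3n+1 : ∀ n → T (suc (n * 3)) ≈ ⊖ (X 1 ⊗ E (J₆.term 5 n))
φ-term-3n+1 n = begin
  T (suc (n * 3))
    ≈⟨ φ-term (suc (n * 3)) ⟩
  ⊖ sgn (n * 3) ⊗ X (suc (n * 3) * suc (n * 3))
    ≈⟨ ⊗-cong (⊖-cong (sgn-*3 n)) (X-cong
         (ℕ-solve 1 (λ n → (κ 1 ⊞ n ⊠ κ 3) ⊠ (κ 1 ⊞ n ⊠ κ 3) ≐
           κ 1 ⊞ (κ 3 ⊠ n ⊠ n ⊞ κ 2 ⊠ n) ⊠ κ 3) refl n)) ⟩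
  ⊖ sgn n ⊗ X (suc (e * 3))
    ≈⟨ solve 2 (λ s x → :- s :* x := :- (s :* x)) ≈-refl (sgn n) _ ⟩
  ⊖ (sgn n ⊗ X (suc (e * 3)))
    ≈⟨ ⊖-cong (≈-sym (≈-trans (⊗-cong ≈-refl (E-signed n e (Ω-term₅ n))) (X⊗-signed n (e * 3)))) ⟩
  ⊖ (X 1 ⊗ E (J₆.term 5 n)) ∎
  where
  open SetoidReasoning setoid
  e = 3 * n * n + 2 * n

-- (3n + 2)² = 1 + 3 (3n² + 4n + 1), which leads to the exponent of Ω at index n + 1.
φ-term-3n+2 : ∀ n → T (2 + n * 3) ≈ ⊖ (X 1 ⊗ E (J₆.term 1 (suc n)))
φ-term-3n+2 n = begin
  T (2 + n * 3)
    ≈⟨ φ-term (2 + n * 3) ⟩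
  ⊖ ⊖ sgn (n * 3) ⊗ X ((2 + n * 3) * (2 + n * 3))
    ≈⟨ ⊗-cong (⊖-cong (⊖-cong (sgn-*3 n))) (X-cong
         (ℕ-solve 1 (λ n → (κ 2 ⊞ n ⊠ κ 3) ⊠ (κ 2 ⊞ n ⊠ κ 3) ≐
           κ 1 ⊞ (κ 3 ⊠ n ⊠ n ⊞ κ 4 ⊠ n ⊞ κ 1) ⊠ κ 3) refl n)) ⟩
  ⊖ sgn (suc n) ⊗ X (suc (e * 3))
    ≈⟨ solve 2 (λ s x → :- s :* x := :- (s :* x)) ≈-refl (sgn (suc n)) _ ⟩
  ⊖ (sgn (suc n) ⊗ X (suc (e * 3)))
    ≈⟨ ⊖-cong (≈-sym (≈-trans (⊗-cong ≈-refl (E-signed (suc n) e (Ω-term₁ n))) (X⊗-signed (suc n) (e * 3)))) ⟩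
  ⊖ (X 1 ⊗ E (J₆.term 1 (suc n))) ∎
  where
  open SetoidReasoning setoid
  e = 3 * n * n + 4 * n + 1

-- Over the integers the second summand would be - 2 q Ω(q³).
φ-dissection : φ ≈ E (E φ) ⊕ X 1 ⊗ E Ω
φ-dissection = ⟶-unique
  (⟶-subsequence (λ n → suc (n * 3)) (λ n → m≤n⇒m≤1+n (m≤m*n n 3)) J₂.θ-partial⟶)
  (⟶-resp (λ n → ≈-sym (partial n))
    (⟶-⊕ (⟶-E (⟶-E J₂.θ-partial⟶)) (⟶-⊗ (⟶-const (X 1)) (⟶-E J₆.θ-partial⟶))))
  where
  open SetoidReasoning setoid
  -- Cutting φ at absolute index 3n + 1 makes all pieces complete: 3k + 1 with k ≤ n gives the
  -- indices 0, ..., -n of Ω, 3k + 2 with k < n gives 1, ..., n, and each index and its negative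
  -- contribute equally to φ.
  partial : ∀ n → J₂.θ-partial (suc (n * 3)) ≈ E (E (J₂.θ-partial n)) ⊕ X 1 ⊗ E (J₆.θ-partial n)
  partial zero = begin
    𝟏 ⊕ (⊖ (X 1 ⊗ 𝟏) ⊕ ⊖ (X 1 ⊗ 𝟏))
      ≈⟨ solve 1 (λ x → con 1₃ :+ (:- (x :* con 1₃) :+ :- (x :* con 1₃)) := con 1₃ :+ x :* con 1₃)
           ≈-refl (X 1) ⟩
    𝟏 ⊕ X 1 ⊗ 𝟏
      ≈⟨ ≈-sym (⊕-cong (≈-trans (E-cong E-𝟏) E-𝟏) (⊗-cong ≈-refl E-𝟏)) ⟩
    E (E 𝟏) ⊕ X 1 ⊗ E 𝟏 ∎
  partial (suc n) = begin
    J₂.θ-partial (suc (n * 3)) ⊕ (T (2 + n * 3) ⊕ T (2 + n * 3))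
      ⊕ (T (suc n * 3) ⊕ T (suc n * 3))
      ⊕ (T (suc (suc n * 3)) ⊕ T (suc (suc n * 3)))
      ≈⟨ ⊕-cong (⊕-cong (⊕-cong (partial n) (double (φ-term-3n+2 n))) (double (φ-term-3n (suc n))))
           (double (φ-term-3n+1 (suc n))) ⟩
    E (E p) ⊕ x ⊗ E o ⊕ (⊖ (x ⊗ u) ⊕ ⊖ (x ⊗ u)) ⊕ (t ⊕ t) ⊕ (⊖ (x ⊗ v) ⊕ ⊖ (x ⊗ v))
      ≈⟨ solve 6 (λ p o x t u v →
           p :+ x :* o :+ (:- (x :* u) :+ :- (x :* u)) :+ (t :+ t) :+ (:- (x :* v) :+ :- (x :* v)) :=
           p :+ (t :+ t) :+ x :* (o :+ (u :+ v))) ≈-refl (E (E p)) (E o) x t u v ⟩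
    E (E p) ⊕ (t ⊕ t) ⊕ x ⊗ (E o ⊕ (u ⊕ v))
      ≈⟨ ≈-sym (⊕-cong
           (≈-trans (E-cong (E-⊕ p _)) (≈-trans (E-⊕ (E p) _) (⊕-cong ≈-refl
             (≈-trans (E-cong (E-⊕ (T (suc n)) (T (suc n)))) (E-⊕ (E (T (suc n))) (E (T (suc n))))))))
           (⊗-cong ≈-refl (≈-trans (E-⊕ o _) (⊕-cong ≈-refl (E-⊕ (J₆.term 1 (suc n)) (J₆.term 5 (suc n))))))) ⟩
    E (E (J₂.θ-partial (suc n))) ⊕ X 1 ⊗ E (J₆.θ-partial (suc n)) ∎
    where
    p = J₂.θ-partial n
    o = J₆.θ-partial n
    x = X 1
    t = E (E (T (suc n)))
    u = E (J₆.term 1 (suc n))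
    v = E (J₆.term 5 (suc n))
    double : ∀ {S S′} → S ≈ S′ → S ⊕ S ≈ S′ ⊕ S′
    double p = ⊕-cong p p

φ₂ : Series
φ₂ = D φ

φ₂-dissection : φ₂ ≈ E (E φ₂) ⊕ X 2 ⊗ E (D Ω)
φ₂-dissection = ≈-trans (D-cong φ-dissection) (≈-trans (D-⊕ (E (E φ)) (X 1 ⊗ E Ω)) (⊕-cong
  (≈-trans (D-E (E φ)) (E-cong (D-E φ)))
  (≈-trans (D-⊗ (X 1) (E Ω)) (⊗-cong (D-X 1) (D-E Ω)))))

φ⊗f₂ : φ ⊗ f 2 ≈ f 1 ⊗ f 1
φ⊗f₂ = ≈-trans (⊗-cong J₂.jacobi ≈-refl) (≈-trans
  (solve 2 (λ c f → c :* c :* f :* f := c :* f :* (c :* f)) ≈-refl (poch∞ 1 2) (f 2))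
  (≈-sym (⊗-cong f₁-split f₁-split)))

φ₂⊗f₄ : φ₂ ⊗ f 4 ≈ f 2 ⊗ f 2
φ₂⊗f₄ = begin
  D φ ⊗ f 4        ≈⟨ ⊗-cong ≈-refl (≈-sym (D-poch∞ 2 2)) ⟩
  D φ ⊗ D (f 2)    ≈⟨ ≈-sym (D-⊗ φ (f 2)) ⟩
  D (φ ⊗ f 2)      ≈⟨ D-cong φ⊗f₂ ⟩
  D (f 1 ⊗ f 1)    ≈⟨ D-⊗ (f 1) (f 1) ⟩
  D (f 1) ⊗ D (f 1) ≈⟨ ⊗-cong (D-poch∞ 1 1) (D-poch∞ 1 1) ⟩
  f 2 ⊗ f 2        ∎
  where open SetoidReasoning setoid

φ-unit : φ ≈[ 1 ] 𝟏
φ-unit = ≈[]-trans (≈⇒≈[] J₂.jacobi) (⊗-unit (⊗-unit (poch∞-unit 1 2) (poch∞-unit 1 2)) (f-unit 2))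

-- Of the auxiliary factor f₁ f₂ f₂, one f₂ turns φ into f₁², which f₁ completes to f₁³ = f₃; with
-- the other f₂ this is the left side of `a-relation`.
a⊗φ : a ⊗ φ ≈ f 2
a⊗φ = ⊗-cancelʳ (f 1 ⊗ f 2 ⊗ f 2) (⊗-unit (⊗-unit (f-unit 1) (f-unit 2)) (f-unit 2)) (begin
  a ⊗ φ ⊗ (f 1 ⊗ f 2 ⊗ f 2)
    ≈⟨ solve 4 (λ a φ f₁ f₂ → a :* φ :* (f₁ :* f₂ :* f₂) := a :* f₂ :* (φ :* f₂) :* f₁) ≈-refl a φ (f 1) (f 2) ⟩
  a ⊗ f 2 ⊗ (φ ⊗ f 2) ⊗ f 1
    ≈⟨ ⊗-cong (⊗-cong ≈-refl φ⊗f₂) ≈-refl ⟩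
  a ⊗ f 2 ⊗ (f 1 ⊗ f 1) ⊗ f 1
    ≈⟨ solve 3 (λ a f₁ f₂ → a :* f₂ :* (f₁ :* f₁) :* f₁ := a :* f₂ :* (f₁ :* f₁ :* f₁)) ≈-refl a (f 1) (f 2) ⟩
  a ⊗ f 2 ⊗ f 1 ³
    ≈⟨ ⊗-cong ≈-refl f₁³≈f₃ ⟩
  a ⊗ f 2 ⊗ f 3
    ≈⟨ a-relation ⟩
  f 1 ⊗ f 6
    ≈⟨ ⊗-cong ≈-refl (≈-sym f₂³≈f₆) ⟩
  f 1 ⊗ f 2 ³
    ≈⟨ solve 2 (λ f₁ f₂ → f₁ :* (f₂ :* f₂ :* f₂) := f₂ :* (f₁ :* f₂ :* f₂)) ≈-refl (f 1) (f 2) ⟩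
  f 2 ⊗ (f 1 ⊗ f 2 ⊗ f 2) ∎)
  where open SetoidReasoning setoid

Ω⊗φ : Ω ⊗ φ ≈ f 2 ⊗ f 2 ³
Ω⊗φ = begin
  Ω ⊗ φ            ≈⟨ ⊗-cong J₆.jacobi ≈-refl ⟩
  a ⊗ f 6 ⊗ φ      ≈⟨ solve 3 (λ a f φ → a :* f :* φ := a :* φ :* f) ≈-refl a (f 6) φ ⟩
  a ⊗ φ ⊗ f 6      ≈⟨ ⊗-cong a⊗φ (≈-sym f₂³≈f₆) ⟩
  f 2 ⊗ f 2 ³      ∎
  where open SetoidReasoning setoid

-- Of the three factors f₂, one becomes a φ and two become φ₂ f₄; then a f₄ cancels against `G`. The
-- cube on the left is what lets the sections of `G` be read off.
E-f₂⊗G : E (f 2) ⊗ G ≈ φ ⊗ φ₂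
E-f₂⊗G = ⊗-cancelʳ (f 4 ³) (⊗-unit (⊗-unit (f-unit 4) (f-unit 4)) (f-unit 4)) (begin
  E (f 2) ⊗ G ⊗ f 4 ³
    ≈⟨ ⊗-cong (⊗-cong (E≈³ (f 2)) ≈-refl) ≈-refl ⟩
  f 2 ³ ⊗ G ⊗ f 4 ³
    ≈⟨ solve 3 (λ g f₂ f₄ → f₂ :* f₂ :* f₂ :* g :* (f₄ :* f₄ :* f₄) :=
         g :* f₂ :* f₄ :* (f₂ :* f₂ :* f₄ :* f₄)) ≈-refl G (f 2) (f 4) ⟩
  G ⊗ f 2 ⊗ f 4 ⊗ (f 2 ⊗ f 2 ⊗ f 4 ⊗ f 4)
    ≈⟨ ⊗-cong (⊗-cong (⊗-cong ≈-refl (≈-sym a⊗φ)) ≈-refl) (⊗-cong (⊗-cong (≈-sym φ₂⊗f₄) ≈-refl) ≈-refl) ⟩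
  G ⊗ (a ⊗ φ) ⊗ f 4 ⊗ (φ₂ ⊗ f 4 ⊗ f 4 ⊗ f 4)
    ≈⟨ solve 5 (λ g a φ ψ f₄ → g :* (a :* φ) :* f₄ :* (ψ :* f₄ :* f₄ :* f₄) :=
         g :* (a :* f₄) :* (φ :* ψ :* (f₄ :* f₄ :* f₄))) ≈-refl G a φ φ₂ (f 4) ⟩
  G ⊗ (a ⊗ f 4) ⊗ (φ ⊗ φ₂ ⊗ f 4 ³)
    ≈⟨ ⊗-cong G-product ≈-refl ⟩
  𝟏 ⊗ (φ ⊗ φ₂ ⊗ f 4 ³)
    ≈⟨ ⊗-identityˡ _ ⟩
  φ ⊗ φ₂ ⊗ f 4 ³ ∎)
  where open SetoidReasoning setoid

-- The three successive sections of G

sec-trisect : ∀ r S₀ S₁ S₂ → sec r (E S₀ ⊗ X 0 ⊕ E S₁ ⊗ X 1 ⊕ E S₂ ⊗ X 2) ≈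
              S₀ ⊗ sec r (X 0) ⊕ S₁ ⊗ sec r (X 1) ⊕ S₂ ⊗ sec r (X 2)
sec-trisect r S₀ S₁ S₂ = ≈-trans
  (≈-trans (sec-⊕ r _ _) (⊕-cong (sec-⊕ r _ _) ≈-refl))
  (⊕-cong (⊕-cong (sec-E⊗ r S₀ (X 0)) (sec-E⊗ r S₁ (X 1))) (sec-E⊗ r S₂ (X 2)))

sec₁-trisect : ∀ S₀ S₁ S₂ → sec 1₃ (E S₀ ⊗ X 0 ⊕ E S₁ ⊗ X 1 ⊕ E S₂ ⊗ X 2) ≈ S₁
sec₁-trisect S₀ S₁ S₂ = ≈-trans (sec-trisect 1₃ S₀ S₁ S₂) (≈-trans
  (⊕-cong (⊕-cong (⊗-cong ≈-refl (coeffwise λ { zero → refl ; (suc n) → refl }))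
                  (⊗-cong ≈-refl (coeffwise λ { zero → refl ; (suc n) → refl })))
                  (⊗-cong ≈-refl (coeffwise λ { zero → refl ; (suc n) → refl })))
  (solve 3 (λ x y z → x :* con 0₃ :+ y :* con 1₃ :+ z :* con 0₃ := y) ≈-refl S₀ S₁ S₂))

sec₂-trisect : ∀ S₀ S₁ S₂ → sec 2₃ (E S₀ ⊗ X 0 ⊕ E S₁ ⊗ X 1 ⊕ E S₂ ⊗ X 2) ≈ S₂
sec₂-trisect S₀ S₁ S₂ = ≈-trans (sec-trisect 2₃ S₀ S₁ S₂) (≈-trans
  (⊕-cong (⊕-cong (⊗-cong ≈-refl (coeffwise λ { zero → refl ; (suc n) → refl }))
                  (⊗-cong ≈-refl (coeffwise λ { zero → refl ; (suc n) → refl })))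
                  (⊗-cong ≈-refl (coeffwise λ { zero → refl ; (suc n) → refl })))
  (solve 3 (λ x y z → x :* con 0₃ :+ y :* con 0₃ :+ z :* con 1₃ := z) ≈-refl S₀ S₁ S₂))

-- Multiplying the two dissections gives the powers 1, q, q², q³ times series in q³. The q³ joins
-- the constant class, so a single product is left in the class of q.
sec₁-φ⊗φ₂ : sec 1₃ (φ ⊗ φ₂) ≈ Ω ⊗ E φ₂
sec₁-φ⊗φ₂ = ≈-trans (sec-cong 1₃ (begin
  φ ⊗ φ₂
    ≈⟨ ⊗-cong φ-dissection φ₂-dissection ⟩
  (E (E φ) ⊕ X 1 ⊗ E Ω) ⊗ (E (E φ₂) ⊕ X 2 ⊗ E (D Ω))
    ≈⟨ ⊗-cong ≈-refl (⊕-cong ≈-refl (⊗-cong (X-+ 1 1) ≈-refl)) ⟩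
  (E (E φ) ⊕ X 1 ⊗ E Ω) ⊗ (E (E φ₂) ⊕ X 1 ⊗ X 1 ⊗ E (D Ω))
    ≈⟨ solve 5 (λ p o r s x → (p :+ x :* o) :* (r :+ x :* x :* s) :=
         (p :* r :+ x :* x :* x :* (o :* s)) :* con 1₃ :+ o :* r :* x :+ p :* s :* (x :* x))
         ≈-refl (E (E φ)) (E Ω) (E (E φ₂)) (E (D Ω)) (X 1) ⟩
  (E (E φ) ⊗ E (E φ₂) ⊕ X 1 ³ ⊗ (E Ω ⊗ E (D Ω))) ⊗ X 0 ⊕ E Ω ⊗ E (E φ₂) ⊗ X 1
    ⊕ E (E φ) ⊗ E (D Ω) ⊗ (X 1 ⊗ X 1)
    ≈⟨ ≈-sym (⊕-cong (⊕-cong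
         (⊗-cong (≈-trans (E-⊕ (E φ ⊗ E φ₂) (X 1 ⊗ (Ω ⊗ D Ω))) (⊕-cong (E-⊗ (E φ) (E φ₂))
           (≈-trans (E-⊗ (X 1) (Ω ⊗ D Ω)) (⊗-cong (E≈³ (X 1)) (E-⊗ Ω (D Ω)))))) ≈-refl)
         (⊗-cong (E-⊗ Ω (E φ₂)) ≈-refl))
         (⊗-cong (E-⊗ (E φ) (D Ω)) (X-+ 1 1))) ⟩
  E (E φ ⊗ E φ₂ ⊕ X 1 ⊗ (Ω ⊗ D Ω)) ⊗ X 0 ⊕ E (Ω ⊗ E φ₂) ⊗ X 1 ⊕ E (E φ ⊗ D Ω) ⊗ X 2 ∎))
  (sec₁-trisect (E φ ⊗ E φ₂ ⊕ X 1 ⊗ (Ω ⊗ D Ω)) (Ω ⊗ E φ₂) (E φ ⊗ D Ω))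
  where open SetoidReasoning setoid

sec₂-φ⊗φ : sec 2₃ (φ ⊗ φ) ≈ Ω ⊗ Ω
sec₂-φ⊗φ = ≈-trans (sec-cong 2₃ (begin
  φ ⊗ φ
    ≈⟨ ⊗-cong φ-dissection φ-dissection ⟩
  (E (E φ) ⊕ X 1 ⊗ E Ω) ⊗ (E (E φ) ⊕ X 1 ⊗ E Ω)
    -- The middle coefficient 2 of the square appears as -1.
    ≈⟨ solve 3 (λ p o x → (p :+ x :* o) :* (p :+ x :* o) :=
         p :* p :* con 1₃ :+ :- (p :* o) :* x :+ o :* o :* (x :* x)) ≈-refl (E (E φ)) (E Ω) (X 1) ⟩
  E (E φ) ⊗ E (E φ) ⊗ X 0 ⊕ ⊖ (E (E φ) ⊗ E Ω) ⊗ X 1 ⊕ E Ω ⊗ E Ω ⊗ (X 1 ⊗ X 1)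
    ≈⟨ ≈-sym (⊕-cong (⊕-cong (⊗-cong (E-⊗ (E φ) (E φ)) ≈-refl)
         (⊗-cong (≈-trans (E-⊖ (E φ ⊗ Ω)) (⊖-cong (E-⊗ (E φ) Ω))) ≈-refl))
         (⊗-cong (E-⊗ Ω Ω) (X-+ 1 1))) ⟩
  E (E φ ⊗ E φ) ⊗ X 0 ⊕ E (⊖ (E φ ⊗ Ω)) ⊗ X 1 ⊕ E (Ω ⊗ Ω) ⊗ X 2 ∎))
  (sec₂-trisect (E φ ⊗ E φ) (⊖ (E φ ⊗ Ω)) (Ω ⊗ Ω))
  where open SetoidReasoning setoid

sec₁-φ₂ : sec 1₃ φ₂ ≈ 𝟎
sec₁-φ₂ = ≈-trans (sec-cong 1₃ (begin
  φ₂
    ≈⟨ φ₂-dissection ⟩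
  E (E φ₂) ⊕ X 2 ⊗ E (D Ω)
    ≈⟨ solve 3 (λ p x o → p :+ x :* o := p :* con 1₃ :+ con 0₃ :+ o :* x) ≈-refl (E (E φ₂)) (X 2) (E (D Ω)) ⟩
  E (E φ₂) ⊗ X 0 ⊕ 𝟎 ⊕ E (D Ω) ⊗ X 2
    ≈⟨ ⊕-cong (⊕-cong ≈-refl (≈-sym E𝟎⊗X)) ≈-refl ⟩
  E (E φ₂) ⊗ X 0 ⊕ E 𝟎 ⊗ X 1 ⊕ E (D Ω) ⊗ X 2 ∎))
  (sec₁-trisect (E φ₂) 𝟎 (D Ω))
  where
  open SetoidReasoning setoid
  E𝟎⊗X : E 𝟎 ⊗ X 1 ≈ 𝟎
  E𝟎⊗X = ≈-trans (⊗-cong (E≈³ 𝟎) ≈-refl)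
    (solve 1 (λ x → con 0₃ :* con 0₃ :* con 0₃ :* x := con 0₃) ≈-refl (X 1))

A₁ A₂ : Series
A₁ = sec 1₃ G
A₂ = sec 2₃ A₁

-- Multiplying by φ trades Ω for f₂⁴; after f₂ cancels, the right side is a cube, ready to leave the
-- next section.
φ⊗A₁ : φ ⊗ A₁ ≈ f 2 ³ ⊗ φ₂ ³
φ⊗A₁ = ⊗-cancelʳ (f 2) (f-unit 2) (begin
  φ ⊗ A₁ ⊗ f 2
    ≈⟨ solve 3 (λ p a f → p :* a :* f := f :* a :* p) ≈-refl φ A₁ (f 2) ⟩
  f 2 ⊗ A₁ ⊗ φ
    ≈⟨ ⊗-cong (≈-trans (≈-sym (sec-E⊗ 1₃ (f 2) G)) (≈-trans (sec-cong 1₃ E-f₂⊗G) sec₁-φ⊗φ₂)) ≈-refl ⟩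
  Ω ⊗ E φ₂ ⊗ φ
    ≈⟨ solve 3 (λ o e p → o :* e :* p := o :* p :* e) ≈-refl Ω (E φ₂) φ ⟩
  Ω ⊗ φ ⊗ E φ₂
    ≈⟨ ⊗-cong Ω⊗φ (E≈³ φ₂) ⟩
  f 2 ⊗ f 2 ³ ⊗ φ₂ ³
    ≈⟨ solve 3 (λ f g p → f :* g :* p := g :* p :* f) ≈-refl (f 2) (f 2 ³) (φ₂ ³) ⟩
  f 2 ³ ⊗ φ₂ ³ ⊗ f 2 ∎)
  where open SetoidReasoning setoid

-- Multiplying `φ⊗A₁` by φ² makes the left factor a cube too, so both cubes lose their exponent in
-- the section and only φ² is really dissected.
φ⊗A₂ : φ ⊗ A₂ ≈ f 2 ⊗ φ₂ ⊗ (Ω ⊗ Ω)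
φ⊗A₂ = begin
  φ ⊗ A₂
    ≈⟨ ≈-sym (sec-E⊗ 2₃ φ A₁) ⟩
  sec 2₃ (E φ ⊗ A₁)
    ≈⟨ sec-cong 2₃ (begin
         E φ ⊗ A₁
           ≈⟨ ⊗-cong (E≈³ φ) ≈-refl ⟩
         φ ³ ⊗ A₁
           ≈⟨ solve 2 (λ p a → p :* p :* p :* a := p :* a :* (p :* p)) ≈-refl φ A₁ ⟩
         φ ⊗ A₁ ⊗ (φ ⊗ φ)
           ≈⟨ ⊗-cong φ⊗A₁ ≈-refl ⟩
         f 2 ³ ⊗ φ₂ ³ ⊗ (φ ⊗ φ)
           ≈⟨ ⊗-cong (≈-sym (≈-trans (E-⊗ (f 2) φ₂) (⊗-cong (E≈³ (f 2)) (E≈³ φ₂)))) ≈-refl ⟩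
         E (f 2 ⊗ φ₂) ⊗ (φ ⊗ φ) ∎) ⟩
  sec 2₃ (E (f 2 ⊗ φ₂) ⊗ (φ ⊗ φ))
    ≈⟨ sec-E⊗ 2₃ (f 2 ⊗ φ₂) (φ ⊗ φ) ⟩
  f 2 ⊗ φ₂ ⊗ sec 2₃ (φ ⊗ φ)
    ≈⟨ ⊗-cong ≈-refl sec₂-φ⊗φ ⟩
  f 2 ⊗ φ₂ ⊗ (Ω ⊗ Ω) ∎
  where open SetoidReasoning setoid

-- The same φ² completes φ³ on the left and pairs with Ω² on the right, leaving f₂⁹, a cube, times
-- φ₂.
sec₁-A₂ : sec 1₃ A₂ ≈ 𝟎
sec₁-A₂ = ⊗-cancelʳ φ φ-unit (begin
  sec 1₃ A₂ ⊗ φ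
    ≈⟨ solve 2 (λ s p → s :* p := p :* s) ≈-refl (sec 1₃ A₂) φ ⟩
  φ ⊗ sec 1₃ A₂
    ≈⟨ ≈-sym (sec-E⊗ 1₃ φ A₂) ⟩
  sec 1₃ (E φ ⊗ A₂)
    ≈⟨ sec-cong 1₃ (begin
         E φ ⊗ A₂
           ≈⟨ ⊗-cong (E≈³ φ) ≈-refl ⟩
         φ ³ ⊗ A₂
           ≈⟨ solve 2 (λ p a → p :* p :* p :* a := p :* a :* (p :* p)) ≈-refl φ A₂ ⟩
         φ ⊗ A₂ ⊗ (φ ⊗ φ)
           ≈⟨ ⊗-cong φ⊗A₂ ≈-refl ⟩
         f 2 ⊗ φ₂ ⊗ (Ω ⊗ Ω) ⊗ (φ ⊗ φ)
           ≈⟨ solve 4 (λ f r o p → f :* r :* (o :* o) :* (p :* p) := f :* r :* (o :* p :* (o :* p)))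
                ≈-refl (f 2) φ₂ Ω φ ⟩
         f 2 ⊗ φ₂ ⊗ (Ω ⊗ φ ⊗ (Ω ⊗ φ))
           ≈⟨ ⊗-cong ≈-refl (⊗-cong Ω⊗φ Ω⊗φ) ⟩
         f 2 ⊗ φ₂ ⊗ (f 2 ⊗ f 2 ³ ⊗ (f 2 ⊗ f 2 ³))
           ≈⟨ solve 3 (λ f r g → f :* r :* (f :* g :* (f :* g)) := f :* f :* f :* (g :* g) :* r)
                ≈-refl (f 2) φ₂ (f 2 ³) ⟩
         f 2 ³ ⊗ (f 2 ³ ⊗ f 2 ³) ⊗ φ₂
           ≈⟨ ⊗-cong (≈-sym (≈-trans (E-⊗ (f 2) (f 2 ⊗ f 2)) (⊗-cong (E≈³ (f 2))
                (≈-trans (E-⊗ (f 2) (f 2)) (⊗-cong (E≈³ (f 2)) (E≈³ (f 2))))))) ≈-refl ⟩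
         E (f 2 ⊗ (f 2 ⊗ f 2)) ⊗ φ₂ ∎) ⟩
  sec 1₃ (E (f 2 ⊗ (f 2 ⊗ f 2)) ⊗ φ₂)
    ≈⟨ sec-E⊗ 1₃ (f 2 ⊗ (f 2 ⊗ f 2)) φ₂ ⟩
  f 2 ⊗ (f 2 ⊗ f 2) ⊗ sec 1₃ φ₂
    ≈⟨ ⊗-cong ≈-refl sec₁-φ₂ ⟩
  f 2 ⊗ (f 2 ⊗ f 2) ⊗ 𝟎
    ≈⟨ solve 2 (λ f p → f :* (f :* f) :* con 0₃ := con 0₃ :* p) ≈-refl (f 2) φ ⟩
  𝟎 ⊗ φ ∎)
  where open SetoidReasoning setoid

theorem1p4 : ∀ (n : ℕ) → dp (27 * n + 16) % 3 ≡ 0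
theorem1p4 n = residue≡0⇒%3≡0 (dp (27 * n + 16)) (begin
  residue (dp (27 * n + 16))                  ≡⟨ sym (G-coeff (27 * n + 16)) ⟩
  G (27 * n + 16)                             ≡⟨ cong G index ⟩
  -- This is `sec 1₃ A₂ n` unfolded: 16 has the digits 1, 2, 1 in base 3, the residues of the
  -- successive sections.
  G (((n * 3 + 1) * 3 + 2) * 3 + 1)           ≡⟨ coeff sec₁-A₂ n ⟩
  𝟎 n                                         ≡⟨ 𝟎-coeff n ⟩
  0₃                                          ∎)
  where
  open ≡-Reasoning
  index : 27 * n + 16 ≡ ((n * 3 + 1) * 3 + 2) * 3 + 1
  index = ℕ-solve 1 (λ n → κ 27 ⊠ n ⊞ κ 16 ≐ ((n ⊠ κ 3 ⊞ κ 1) ⊠ κ 3 ⊞ κ 2) ⊠ κ 3 ⊞ κ 1) refl n
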